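{- Let $n\ge 1$ be an integer. Put $e=\lceil \log_2(n)\rceil$ and $f=\lceil \log_5(5n/4)\rceil$. Then $$D_S(n)=\min\{2^e,5^f\}.$$
   Context: The Salajan sequence is $u_1,u_2,\ldots$ with $u_j=(3^j-5(-1)^j)/4$ for $j\ge 1$ (so $u_1=2,u_2=1,u_3=8,u_4=19,\ldots$); its terms are distinct positive integers. For $n\ge1$, the discriminator $D_S(n)$ is the smallest positive integer $m$ such that $u_1,\ldots,u_n$ are pairwise incongruent modulo $m$. -}

module Defs where

open import Data.Nat as ℕ using (ℕ; zero; suc; _≤_; _<_; NonZero)
open import Data.Integer as ℤ using (ℤ; +_; _-_; _*_)
open import Data.Integer.DivMod using () renaming (_/_ to _/ℤ_)
open import Data.Integer.Divisibility using () renaming (_∣_ to _∣ℤ_)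
open import Relation.Binary.PropositionalEquality using (_≡_)
open import Data.Product using (_×_)
open import Relation.Nullary using (¬_)

sgn : ℕ → ℤ
sgn zero = + 1
sgn (suc j) = ℤ.- sgn j

-- Salajan sequence u_j = (3^j - 5(-1)^j)/4 (exact division; used for j ≥ 1)
u : ℕ → ℤ
u j = ((+ (3 ℕ.^ j)) - (+ 5) * sgn j) /ℤ (+ 4)

Discriminates : ℕ → ℕ → Set
Discriminates n m =
  ∀ i j → 1 ≤ i → i ≤ n → 1 ≤ j → j ≤ n →
    (+ m) ∣ℤ (u i - u j) → i ≡ j

IsDiscriminator : ℕ → ℕ → Set
IsDiscriminator n m =
  1 ≤ m × Discriminates n m × (∀ k → 1 ≤ k → k < m → ¬ Discriminates n k)

IsCeilLog5-5n/4 : ℕ → ℕ → Set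
IsCeilLog5-5n/4 n f =
  5 ℕ.* n ≤ 4 ℕ.* (5 ℕ.^ f) × (∀ g → 5 ℕ.* n ≤ 4 ℕ.* (5 ℕ.^ g) → f ≤ g)

{-# OPTIONS --safe #-}

-- Terms of equal parity satisfy u (i + 2 d) − u i = 2 · 3^i · (9^d − 1) / 8, so lifting the exponent at
-- 2 and at 5 shows that 2^e and 5^f discriminate.  A smaller m satisfies m + 3 ≤ 2 n.  Powers of 2 and of
-- 5 below the minimum fail by counting, and every other m is a multiple of 6, 9, 10 or 15, equals 3, or
-- has a prime factor p ≥ 7; a period of length at most d / 2 modulo some divisor d of m rules out all but
-- the last case.  For p = 2 h + 1 some two of u 1, …, u (h + 1) agree mod p: otherwise
-- 9^a ≢ 3 · 9^b + 10 for all small a and b, and multiplying by powers of 9 yields L² lines over F_p that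
-- avoid all L² points (9^(L+i), 3 · 9^j), where L ≈ p / 8.  A second-moment count of incidences gives
-- L⁴ ≤ p³, hence p ≤ 9⁴, and these primes are checked by computation.
module Submission where

open import Defs
open import Data.Nat as ℕ using (ℕ; zero; suc; _≤_; _<_; _^_; _+_; _*_; _∸_; _⊓_; z≤n; s≤s; NonZero; ⌈_/2⌉; ⌊_/2⌋)
import Data.Nat.Properties as ℕ
open import Data.Nat.Divisibility using (_∣_; divides; _∣?_)
import Data.Nat.Divisibility as ℕ
import Data.Nat.DivMod as ℕ
open import Data.Nat.Induction using (<-rec)
open import Data.Nat.ListAction using (product)
open import Data.Nat.Logarithm using (⌈log₂_⌉; ⌈log₂⌉-mono-≤; ⌈log₂⌈n/2⌉⌉≡⌈log₂n⌉∸1; ⌈log₂2^n⌉≡n)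
open import Data.Nat.Primality using (Prime; euclidsLemma; prime?; prime[2]; prime⇒nonZero; prime⇒irreducible)
open import Data.Nat.Primality.Factorisation using (factorise; module PrimeFactorisation)
import Data.Nat.Tactic.RingSolver as ℕ-Ring
open import Data.Integer as ℤ using (ℤ; +_; ∣_∣)
import Data.Integer.Properties as ℤ
import Data.Integer.DivMod as ℤ
open import Data.Integer.Divisibility.Signed as ℤ using (∣ᵤ⇒∣; ∣⇒∣ᵤ)
import Data.Integer.Tactic.RingSolver as ℤ-Ring
open import Data.Bool using (Bool; true; false; _∨_; _∧_; T)
open import Data.Bool.Properties using (T-∨; T-∧; T-≡)
open import Data.Fin as Fin using (Fin; zero; suc; toℕ; fromℕ<)
import Data.Fin.Properties as Fin
open import Data.List using (List; []; _∷_)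
open import Data.List.Relation.Unary.All as All using (All; []; _∷_)
open import Data.Sum using (_⊎_; inj₁; inj₂)
open import Data.Product using (∃; ∃₂; _×_; _,_; proj₁; proj₂)
open import Function using (_∘_; Equivalence)
open import Relation.Nullary using (¬_; Dec; yes; no; contradiction)
open import Relation.Nullary.Decidable using (from-yes; from-no)
open import Relation.Binary.PropositionalEquality
open import Algebra.Properties.Semiring.Sum ℕ.+-*-semiring
  using (sum; sum-cong-≗; ∑-distrib-+; ∑-comm; *-distribˡ-sum; *-distribʳ-sum)

-- The sequence

-- The obstacle is the size of the range: m + 3 ≤ 2 n provides only about m / 2 terms, whereas the
-- period mod a prime p can be as long as p - 1. In that case equal-parity terms in the range are
-- all distinct, and a collision has to pair an even index with an odd one. Four times such a
-- difference is 9^a - 3 · 9^b - 10, so the question is additive: whether an affine image of one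
-- short geometric progression meets another. Orders of elements say nothing about this, and
-- character sums would be the usual tool; the incidence count replaces them by a variance argument
-- in natural numbers. The prime 5 is a true exception: its period is 4, and 2, 1, 8, 19 are
-- distinct mod 5. This is why its powers survive and why the threshold for them is 4 · 5^(f - 1),
-- the period mod 5^f.

exact-quotient : ∀ a v → a ≡ v ℤ.* + 4 → a ℤ./ + 4 ≡ v
exact-quotient a v a≡4v = ℤ.*-cancelʳ-≡ q v (+ 4) (begin
  q ℤ.* + 4           ≡⟨ ℤ.+-identityˡ _ ⟨
  + 0 ℤ.+ q ℤ.* + 4   ≡⟨ cong (λ r → + r ℤ.+ q ℤ.* + 4) r≡0 ⟨
  + r ℤ.+ q ℤ.* + 4   ≡⟨ ℤ.a≡a%n+[a/n]*n a (+ 4) ⟨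
  a                   ≡⟨ a≡4v ⟩
  v ℤ.* + 4           ∎)
  where
  open ≡-Reasoning
  q = a ℤ./ + 4
  r = a ℤ.% + 4
  rearrange : ∀ r q v → r ≡ (r ℤ.+ q ℤ.* + 4) ℤ.- v ℤ.* + 4 ℤ.+ (v ℤ.- q) ℤ.* + 4
  rearrange = ℤ-Ring.solve-∀
  4∣r : (+ 4) ℤ.∣ + r
  4∣r = ℤ.divides (v ℤ.- q) (begin
    + r ≡⟨ rearrange (+ r) q v ⟩
    (+ r ℤ.+ q ℤ.* + 4) ℤ.- v ℤ.* + 4 ℤ.+ (v ℤ.- q) ℤ.* + 4
      ≡⟨ cong (λ z → z ℤ.- v ℤ.* + 4 ℤ.+ (v ℤ.- q) ℤ.* + 4) (trans (sym (ℤ.a≡a%n+[a/n]*n a (+ 4))) a≡4v) ⟩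
    v ℤ.* + 4 ℤ.- v ℤ.* + 4 ℤ.+ (v ℤ.- q) ℤ.* + 4
      ≡⟨ cong (ℤ._+ (v ℤ.- q) ℤ.* + 4) (ℤ.+-inverseʳ (v ℤ.* + 4)) ⟩
    + 0 ℤ.+ (v ℤ.- q) ℤ.* + 4 ≡⟨ ℤ.+-identityˡ _ ⟩
    (v ℤ.- q) ℤ.* + 4 ∎)
  r≡0 : r ≡ 0
  r≡0 with r | ∣⇒∣ᵤ 4∣r | ℤ.n%d<d a (+ 4)
  ... | zero  | _ | _ = refl
  ... | suc r | d | r<4 = contradiction d (ℕ.>⇒∤ r<4)

4∣3^j-5sgn : ∀ j → ∃ λ v → + (3 ^ j) ℤ.- + 5 ℤ.* sgn j ≡ v ℤ.* + 4
4∣3^j-5sgn zero = ℤ.- + 1 , refl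
4∣3^j-5sgn (suc j) with v , eq ← 4∣3^j-5sgn j = + 3 ℤ.* v ℤ.+ + 5 ℤ.* s , (begin
  + (3 * 3 ^ j) ℤ.- + 5 ℤ.* (ℤ.- s)       ≡⟨ cong (ℤ._- + 5 ℤ.* (ℤ.- s)) (ℤ.pos-* 3 (3 ^ j)) ⟩
  + 3 ℤ.* t ℤ.- + 5 ℤ.* (ℤ.- s)           ≡⟨ lhs s t ⟩
  + 3 ℤ.* (t ℤ.- + 5 ℤ.* s) ℤ.+ + 20 ℤ.* s ≡⟨ cong (λ z → + 3 ℤ.* z ℤ.+ + 20 ℤ.* s) eq ⟩
  + 3 ℤ.* (v ℤ.* + 4) ℤ.+ + 20 ℤ.* s      ≡⟨ rhs v s ⟩
  (+ 3 ℤ.* v ℤ.+ + 5 ℤ.* s) ℤ.* + 4       ∎)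
  where
  open ≡-Reasoning
  s = sgn j
  t = + (3 ^ j)
  lhs : ∀ s t → + 3 ℤ.* t ℤ.- + 5 ℤ.* (ℤ.- s) ≡ + 3 ℤ.* (t ℤ.- + 5 ℤ.* s) ℤ.+ + 20 ℤ.* s
  lhs = ℤ-Ring.solve-∀
  rhs : ∀ v s → + 3 ℤ.* (v ℤ.* + 4) ℤ.+ + 20 ℤ.* s ≡ (+ 3 ℤ.* v ℤ.+ + 5 ℤ.* s) ℤ.* + 4
  rhs = ℤ-Ring.solve-∀

u-closed : ∀ j → u j ℤ.* + 4 ≡ + (3 ^ j) ℤ.- + 5 ℤ.* sgn j
u-closed j with v , eq ← 4∣3^j-5sgn j = trans (cong (ℤ._* + 4) (exact-quotient _ v eq)) (sym eq)

u-step : ∀ j → u (suc j) ≡ + 3 ℤ.* u j ℤ.+ + 5 ℤ.* sgn j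
u-step j = ℤ.*-cancelʳ-≡ _ _ (+ 4) (begin
  u (suc j) ℤ.* + 4                                   ≡⟨ u-closed (suc j) ⟩
  + (3 * 3 ^ j) ℤ.- + 5 ℤ.* sgn (suc j)               ≡⟨ cong (ℤ._- + 5 ℤ.* sgn (suc j)) (ℤ.pos-* 3 (3 ^ j)) ⟩
  + 3 ℤ.* + (3 ^ j) ℤ.- + 5 ℤ.* (ℤ.- sgn j)           ≡⟨ lhs (sgn j) (+ (3 ^ j)) ⟩
  + 3 ℤ.* (+ (3 ^ j) ℤ.- + 5 ℤ.* sgn j) ℤ.+ + 20 ℤ.* sgn j ≡⟨ cong (λ z → + 3 ℤ.* z ℤ.+ + 20 ℤ.* sgn j) (u-closed j) ⟨
  + 3 ℤ.* (u j ℤ.* + 4) ℤ.+ + 20 ℤ.* sgn j            ≡⟨ rhs (u j) (sgn j) ⟩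
  (+ 3 ℤ.* u j ℤ.+ + 5 ℤ.* sgn j) ℤ.* + 4             ∎)
  where
  open ≡-Reasoning
  lhs : ∀ s t → + 3 ℤ.* t ℤ.- + 5 ℤ.* (ℤ.- s) ≡ + 3 ℤ.* (t ℤ.- + 5 ℤ.* s) ℤ.+ + 20 ℤ.* s
  lhs = ℤ-Ring.solve-∀
  rhs : ∀ v s → + 3 ℤ.* (v ℤ.* + 4) ℤ.+ + 20 ℤ.* s ≡ (+ 3 ℤ.* v ℤ.+ + 5 ℤ.* s) ℤ.* + 4
  rhs = ℤ-Ring.solve-∀

-- The geometric sum 1 + (1 + b) + ⋯ + (1 + b)^(d - 1), that is ((1 + b)^d - 1) / b without a
-- division. `rep 8` belongs to the base 9 and `rep 80` to the base 81.
rep : ℕ → ℕ → ℕ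
rep b zero    = 0
rep b (suc d) = 1 + (1 + b) * rep b d

suc-^ : ∀ b d → (1 + b) ^ d ≡ 1 + b * rep b d
suc-^ b zero    = cong suc (sym (ℕ.*-zeroʳ b))
suc-^ b (suc d) = trans (cong ((1 + b) *_) (suc-^ b d)) (expand b (rep b d))
  where
  expand : ∀ b r → (1 + b) * (1 + b * r) ≡ 1 + b * (1 + (1 + b) * r)
  expand = ℕ-Ring.solve-∀

sgn-double : ∀ i d → sgn (i + 2 * d) ≡ sgn i
sgn-double i zero    = cong sgn (ℕ.+-identityʳ i)
sgn-double i (suc d) = begin
  sgn (i + 2 * suc d)       ≡⟨ cong sgn (shift i d) ⟩
  sgn (suc (suc (i + 2 * d))) ≡⟨ ℤ.neg-involutive _ ⟩
  sgn (i + 2 * d)           ≡⟨ sgn-double i d ⟩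
  sgn i                     ∎
  where
  open ≡-Reasoning
  shift : ∀ i d → i + 2 * suc d ≡ suc (suc (i + 2 * d))
  shift = ℕ-Ring.solve-∀

-- Over an even gap the alternating summands cancel, so collisions of equal parity depend on
-- `rep 8 d` and the prime factors 2 and 3 alone.
u-shift : ∀ i d → u (i + 2 * d) ℤ.- u i ≡ + (2 * 3 ^ i * rep 8 d)
u-shift i d = ℤ.*-cancelʳ-≡ _ _ (+ 4) (begin
  (u (i + 2 * d) ℤ.- u i) ℤ.* + 4
    ≡⟨ ℤ.*-distribʳ-+ (+ 4) (u (i + 2 * d)) (ℤ.- u i) ⟩
  u (i + 2 * d) ℤ.* + 4 ℤ.+ ℤ.- u i ℤ.* + 4
    ≡⟨ cong (λ y → u (i + 2 * d) ℤ.* + 4 ℤ.+ y) (sym (ℤ.neg-distribˡ-* (u i) (+ 4))) ⟩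
  u (i + 2 * d) ℤ.* + 4 ℤ.- u i ℤ.* + 4
    ≡⟨ cong₂ ℤ._-_ (u-closed (i + 2 * d)) (u-closed i) ⟩
  (+ (3 ^ (i + 2 * d)) ℤ.- + 5 ℤ.* sgn (i + 2 * d)) ℤ.- (t ℤ.- + 5 ℤ.* sgn i)
    ≡⟨ cong₂ (λ x s → (+ x ℤ.- + 5 ℤ.* s) ℤ.- (t ℤ.- + 5 ℤ.* sgn i)) power (sgn-double i d) ⟩
  (+ (3 ^ i + 2 * 3 ^ i * rep 8 d * 4) ℤ.- + 5 ℤ.* sgn i) ℤ.- (t ℤ.- + 5 ℤ.* sgn i)
    ≡⟨ cong (λ x → (x ℤ.- + 5 ℤ.* sgn i) ℤ.- (t ℤ.- + 5 ℤ.* sgn i))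
         (trans (ℤ.pos-+ (3 ^ i) _) (cong (λ y → t ℤ.+ y) (ℤ.pos-* (2 * 3 ^ i * rep 8 d) 4))) ⟩
  (t ℤ.+ + (2 * 3 ^ i * rep 8 d) ℤ.* + 4 ℤ.- + 5 ℤ.* sgn i) ℤ.- (t ℤ.- + 5 ℤ.* sgn i)
    ≡⟨ cancel t (+ (2 * 3 ^ i * rep 8 d)) (sgn i) ⟩
  + (2 * 3 ^ i * rep 8 d) ℤ.* + 4 ∎)
  where
  open ≡-Reasoning
  t = + (3 ^ i)
  cancel : ∀ t g s → (t ℤ.+ g ℤ.* + 4 ℤ.- + 5 ℤ.* s) ℤ.- (t ℤ.- + 5 ℤ.* s) ≡ g ℤ.* + 4
  cancel = ℤ-Ring.solve-∀
  expand : ∀ t r → t * (1 + 8 * r) ≡ t + 2 * t * r * 4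
  expand = ℕ-Ring.solve-∀
  power : 3 ^ (i + 2 * d) ≡ 3 ^ i + 2 * 3 ^ i * rep 8 d * 4
  power = begin
    3 ^ (i + 2 * d)        ≡⟨ ℕ.^-distribˡ-+-* 3 i (2 * d) ⟩
    3 ^ i * 3 ^ (2 * d)    ≡⟨ cong (3 ^ i *_) (ℕ.^-*-assoc 3 2 d) ⟨
    3 ^ i * 9 ^ d          ≡⟨ cong (3 ^ i *_) (suc-^ 8 d) ⟩
    3 ^ i * (1 + 8 * rep 8 d) ≡⟨ expand (3 ^ i) (rep 8 d) ⟩
    3 ^ i + 2 * 3 ^ i * rep 8 d * 4 ∎

-- For opposite parities the alternating summands reinforce each other to 10. This inhomogeneous
-- term is what produces the intercepts of the lines over F_p.
u-opposite : ∀ a b → (u (2 * a) ℤ.- u (1 + 2 * b)) ℤ.* + 4 ≡ + (9 ^ a) ℤ.- (+ 3 ℤ.* + (9 ^ b) ℤ.+ + 10)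
u-opposite a b = begin
  (u (2 * a) ℤ.- u (1 + 2 * b)) ℤ.* + 4
    ≡⟨ ℤ.*-distribʳ-+ (+ 4) (u (2 * a)) (ℤ.- u (1 + 2 * b)) ⟩
  u (2 * a) ℤ.* + 4 ℤ.+ ℤ.- u (1 + 2 * b) ℤ.* + 4
    ≡⟨ cong (λ y → u (2 * a) ℤ.* + 4 ℤ.+ y) (sym (ℤ.neg-distribˡ-* (u (1 + 2 * b)) (+ 4))) ⟩
  u (2 * a) ℤ.* + 4 ℤ.- u (1 + 2 * b) ℤ.* + 4
    ≡⟨ cong₂ ℤ._-_ (u-closed (2 * a)) (u-closed (1 + 2 * b)) ⟩
  (+ (3 ^ (2 * a)) ℤ.- + 5 ℤ.* sgn (2 * a)) ℤ.- (+ (3 * 3 ^ (2 * b)) ℤ.- + 5 ℤ.* (ℤ.- sgn (2 * b)))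
    ≡⟨ cong₂ (λ s s′ → (+ (3 ^ (2 * a)) ℤ.- + 5 ℤ.* s) ℤ.- (+ (3 * 3 ^ (2 * b)) ℤ.- + 5 ℤ.* (ℤ.- s′)))
         (sgn-double 0 a) (sgn-double 0 b) ⟩
  (+ (3 ^ (2 * a)) ℤ.- + 5) ℤ.- (+ (3 * 3 ^ (2 * b)) ℤ.- + 5 ℤ.* (ℤ.- + 1))
    ≡⟨ cong₂ (λ x y → (+ x ℤ.- + 5) ℤ.- (+ (3 * y) ℤ.- + 5 ℤ.* (ℤ.- + 1)))
         (ℕ.^-*-assoc 3 2 a) (ℕ.^-*-assoc 3 2 b) ⟨
  (+ (9 ^ a) ℤ.- + 5) ℤ.- (+ (3 * 9 ^ b) ℤ.- + 5 ℤ.* (ℤ.- + 1))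
    ≡⟨ cong (λ y → (+ (9 ^ a) ℤ.- + 5) ℤ.- (y ℤ.- + 5 ℤ.* (ℤ.- + 1))) (ℤ.pos-* 3 (9 ^ b)) ⟩
  (+ (9 ^ a) ℤ.- + 5) ℤ.- (+ 3 ℤ.* + (9 ^ b) ℤ.- + 5 ℤ.* (ℤ.- + 1))
    ≡⟨ collect (+ (9 ^ a)) (+ 3 ℤ.* + (9 ^ b)) ⟩
  + (9 ^ a) ℤ.- (+ 3 ℤ.* + (9 ^ b) ℤ.+ + 10) ∎
  where
  open ≡-Reasoning
  collect : ∀ x y → (x ℤ.- + 5) ℤ.- (y ℤ.- + 5 ℤ.* (ℤ.- + 1)) ≡ x ℤ.- (y ℤ.+ + 10)
  collect = ℤ-Ring.solve-∀

-- Pigeonhole in residue classes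

residue : ∀ q → .{{NonZero q}} → ℤ → Fin q
residue q a = fromℕ< (ℤ.n%ℕd<d a q)

residue-≡ : ∀ q .{{_ : NonZero q}} a b → residue q a ≡ residue q b → + q ℤ.∣ a ℤ.- b
residue-≡ q a b eq = ℤ.divides (a ℤ./ℕ q ℤ.- b ℤ./ℕ q) (begin
  a ℤ.- b ≡⟨ cong₂ ℤ._-_ (ℤ.a≡a%ℕn+[a/ℕn]*n a q) (ℤ.a≡a%ℕn+[a/ℕn]*n b q) ⟩
  (+ (a ℤ.%ℕ q) ℤ.+ (a ℤ./ℕ q) ℤ.* + q) ℤ.- (+ (b ℤ.%ℕ q) ℤ.+ (b ℤ./ℕ q) ℤ.* + q)
    ≡⟨ cong (λ r → (+ r ℤ.+ (a ℤ./ℕ q) ℤ.* + q) ℤ.- (+ (b ℤ.%ℕ q) ℤ.+ (b ℤ./ℕ q) ℤ.* + q)) %-≡ ⟩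
  (+ (b ℤ.%ℕ q) ℤ.+ (a ℤ./ℕ q) ℤ.* + q) ℤ.- (+ (b ℤ.%ℕ q) ℤ.+ (b ℤ./ℕ q) ℤ.* + q)
    ≡⟨ cancel (+ (b ℤ.%ℕ q)) (a ℤ./ℕ q) (b ℤ./ℕ q) (+ q) ⟩
  (a ℤ./ℕ q ℤ.- b ℤ./ℕ q) ℤ.* + q ∎)
  where
  open ≡-Reasoning
  %-≡ : a ℤ.%ℕ q ≡ b ℤ.%ℕ q
  %-≡ = Fin.fromℕ<-injective _ _ (ℤ.n%ℕd<d a q) (ℤ.n%ℕd<d b q) eq
  cancel : ∀ r x y q → (r ℤ.+ x ℤ.* q) ℤ.- (r ℤ.+ y ℤ.* q) ≡ (x ℤ.- y) ℤ.* q
  cancel = ℤ-Ring.solve-∀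

-- Within one class mod d there are only q classes mod d q.
crowded-class : ∀ {n} d q .{{_ : NonZero q}} c (f : Fin (suc q) → ℕ) →
  (∀ s → 1 ≤ f s × f s ≤ n) → (∀ {s s′} → f s ≡ f s′ → s ≡ s′) →
  (∀ s → + d ℤ.∣ u (f s) ℤ.- c) → ¬ Discriminates n (d * q)
crowded-class d q c f f-range f-inj f-class disc
  with s , s′ , s<s′ , eq ← Fin.pigeonhole (ℕ.n<1+n q) (λ s → residue q (ℤ.quotient (f-class s)))
  = Fin.<⇒≢ s<s′ (f-inj (disc (f s) (f s′)
      (proj₁ (f-range s)) (proj₂ (f-range s)) (proj₁ (f-range s′)) (proj₂ (f-range s′)) (∣⇒∣ᵤ dq∣)))
  where
  k : Fin (suc q) → ℤ
  k s = ℤ.quotient (f-class s)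
  regroup : ∀ x y c → x ℤ.- y ≡ (x ℤ.- c) ℤ.- (y ℤ.- c)
  regroup = ℤ-Ring.solve-∀
  collect : ∀ z q d k k′ → k ℤ.- k′ ≡ z ℤ.* q → k ℤ.* d ℤ.- k′ ℤ.* d ≡ z ℤ.* (d ℤ.* q)
  collect z q d k k′ eq = trans (sym (factor k k′ d)) (trans (cong (ℤ._* d) eq) (swap z q d))
    where
    factor : ∀ k k′ d → (k ℤ.- k′) ℤ.* d ≡ k ℤ.* d ℤ.- k′ ℤ.* d
    factor = ℤ-Ring.solve-∀
    swap : ∀ z q d → z ℤ.* q ℤ.* d ≡ z ℤ.* (d ℤ.* q)
    swap = ℤ-Ring.solve-∀
  dq∣ : + (d * q) ℤ.∣ u (f s) ℤ.- u (f s′)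
  dq∣ with ℤ.divides z k-k′≡zq ← residue-≡ q (k s) (k s′) eq = ℤ.divides z (begin
    u (f s) ℤ.- u (f s′)                   ≡⟨ regroup (u (f s)) (u (f s′)) c ⟩
    (u (f s) ℤ.- c) ℤ.- (u (f s′) ℤ.- c)   ≡⟨ cong₂ ℤ._-_ (ℤ._∣_.equality (f-class s)) (ℤ._∣_.equality (f-class s′)) ⟩
    k s ℤ.* + d ℤ.- k s′ ℤ.* + d           ≡⟨ collect z (+ q) (+ d) (k s) (k s′) k-k′≡zq ⟩
    z ℤ.* (+ d ℤ.* + q)                    ≡⟨ cong (z ℤ.*_) (ℤ.pos-* d q) ⟨
    z ℤ.* + (d * q)                        ∎)
    where open ≡-Reasoning

-- Lifting the exponent

rep-+ : ∀ b k l → rep b (k + l) ≡ rep b k + (1 + b) ^ k * rep b l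
rep-+ b zero    l = sym (ℕ.*-identityˡ _)
rep-+ b (suc k) l = trans (cong (λ r → 1 + (1 + b) * r) (rep-+ b k l)) (expand b (rep b k) ((1 + b) ^ k) (rep b l))
  where
  expand : ∀ b x y z → 1 + (1 + b) * (x + y * z) ≡ (1 + (1 + b) * x) + (1 + b) * y * z
  expand = ℕ-Ring.solve-∀

-- With x = 1 + b and y = x^k, this is (y^m - 1) / (x - 1) = (y - 1) / (x - 1) · (y^m - 1) / (y -
-- 1); by `suc-^`, y = 1 + b * rep b k.
rep-* : ∀ b m k → rep b (m * k) ≡ rep b k * rep (b * rep b k) m
rep-* b zero    k = sym (ℕ.*-zeroʳ (rep b k))
rep-* b (suc m) k = begin
  rep b (k + m * k)                      ≡⟨ rep-+ b k (m * k) ⟩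
  R + (1 + b) ^ k * rep b (m * k)        ≡⟨ cong₂ (λ x y → R + x * y) (suc-^ b k) (rep-* b m k) ⟩
  R + (1 + b * R) * (R * rep (b * R) m)  ≡⟨ expand R (b * R) (rep (b * R) m) ⟩
  R * (1 + (1 + b * R) * rep (b * R) m)  ∎
  where
  open ≡-Reasoning
  R = rep b k
  expand : ∀ r b x → r + (1 + b) * (r * x) ≡ r * (1 + (1 + b) * x)
  expand = ℕ-Ring.solve-∀

-- Each of the d summands (1 + b)^i is 1 mod b.
rep-mod : ∀ b d → ∃ λ c → rep b d ≡ d + b * c
rep-mod b zero = 0 , sym (ℕ.*-zeroʳ b)
rep-mod b (suc d) with c , eq ← rep-mod b d =
  rep b d + c , trans (expand b (rep b d)) (trans (cong (λ r → 1 + r + b * rep b d) eq) (collect b d c (rep b d)))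
  where
  expand : ∀ b r → 1 + (1 + b) * r ≡ 1 + r + b * r
  expand = ℕ-Ring.solve-∀
  collect : ∀ b d c r → 1 + (d + b * c) + b * r ≡ 1 + d + b * (r + c)
  collect = ℕ-Ring.solve-∀

prime-power-cancel : ∀ {p} → Prime p → ∀ c {x y} → ¬ p ∣ x → p ^ c ∣ y * x → p ^ c ∣ y
prime-power-cancel pp zero    _   _ = ℕ.1∣ _
prime-power-cancel {p} pp (suc c) {x} {y} p∤x d with euclidsLemma y x pp (ℕ.∣-trans (ℕ.m∣m*n (p ^ c)) d)
... | inj₂ p∣x = contradiction p∣x p∤x
... | inj₁ (divides y′ refl) = subst (p ^ suc c ∣_) (ℕ.*-comm p y′) (ℕ.*-monoʳ-∣ p
        (prime-power-cancel pp c p∤x (ℕ.*-cancelˡ-∣ p {{prime⇒nonZero pp}} (subst (p * p ^ c ∣_) (swap y′ p x) d))))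
  where
  swap : ∀ y p x → y * p * x ≡ p * (y * x)
  swap = ℕ-Ring.solve-∀

1+p*c-unit : ∀ {p} → Prime p → ∀ c → ¬ p ∣ 1 + p * c
1+p*c-unit {p} pp c d =
  contradiction (subst Prime (ℕ.∣1⇒≡1 (ℕ.∣m+n∣m⇒∣n (subst (p ∣_) (ℕ.+-comm 1 (p * c)) d) (ℕ.m∣m*n c))) pp) (from-no (prime? 1))

-- Since p divides b, `rep-mod` turns p ∣ rep b d into p ∣ d. Writing d = k p, `rep-*` splits off
-- the cofactor of the p-th power, which by hypothesis contains p exactly once; cancelling it leaves
-- the same claim for k and a smaller exponent.
lift-exponent : ∀ {p} b → Prime p → p ∣ b → (∀ k → ∃ λ c → rep (b * rep b k) p ≡ p * (1 + p * c)) →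
  ∀ c d → p ^ c ∣ rep b d → p ^ c ∣ d
lift-exponent b pp p∣b factor zero d _ = ℕ.1∣ d
lift-exponent {p} b pp p∣b factor (suc c) d pᶜ∣rep with rep-mod b d
... | x , eq with ℕ.∣m+n∣m⇒∣n (subst (p ∣_) (trans eq (ℕ.+-comm d (b * x))) (ℕ.∣-trans (ℕ.m∣m*n (p ^ c)) pᶜ∣rep)) (ℕ.∣m⇒∣m*n x p∣b)
... | divides k refl with y , eq′ ← factor k =
  subst (p ^ suc c ∣_) (ℕ.*-comm p k) (ℕ.*-monoʳ-∣ p (lift-exponent b pp p∣b factor c k
    (prime-power-cancel pp c (1+p*c-unit pp y) (ℕ.*-cancelˡ-∣ p {{prime⇒nonZero pp}} (subst (p * p ^ c ∣_) rep-kp pᶜ∣rep)))))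
  where
  open ≡-Reasoning
  swap : ∀ r p z → r * (p * z) ≡ p * (r * z)
  swap = ℕ-Ring.solve-∀
  rep-kp : rep b (k * p) ≡ p * (rep b k * (1 + p * y))
  rep-kp = begin
    rep b (k * p)                   ≡⟨ cong (rep b) (ℕ.*-comm k p) ⟩
    rep b (p * k)                   ≡⟨ rep-* b p k ⟩
    rep b k * rep (b * rep b k) p   ≡⟨ cong (rep b k *_) eq′ ⟩
    rep b k * (p * (1 + p * y))     ≡⟨ swap (rep b k) p (1 + p * y) ⟩
    p * (rep b k * (1 + p * y))     ∎

prime[3] : Prime 3
prime[3] = from-yes (prime? 3)

prime[5] : Prime 5
prime[5] = from-yes (prime? 5)

2^∣rep : ∀ c d → 2 ^ c ∣ rep 8 d → 2 ^ c ∣ d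
2^∣rep = lift-exponent 8 prime[2] (divides 4 refl) λ k → 2 * rep 8 k , expand (rep 8 k)
  where
  expand : ∀ r → 1 + (1 + 8 * r) * (1 + (1 + 8 * r) * 0) ≡ 2 * (1 + 2 * (2 * r))
  expand = ℕ-Ring.solve-∀

-- Lifting needs a base that is 1 mod 5. As 9 is -1 mod 5, its square 81 is used.
5^∣rep : ∀ c d → 5 ^ c ∣ rep 80 d → 5 ^ c ∣ d
5^∣rep = lift-exponent 80 prime[5] (divides 16 refl) λ k →
  cofactor (16 * rep 80 k) , trans (cong (λ b → rep b 5) (ℕ.*-assoc 5 16 (rep 80 k))) (expand (16 * rep 80 k))
  where
  -- Read off from ((1 + 5 x)^5 - 1) / (5 x) = 5 + 50 x + 250 x² + 625 x³ + 625 x⁴, with 5 x = 80 *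
  -- rep 80 k.
  cofactor : ℕ → ℕ
  cofactor x = 2 * x + 10 * (x * x) + 25 * (x * x * x) + 25 * (x * x * x * x)
  expand : ∀ x → 1 + (1 + 5 * x) * (1 + (1 + 5 * x) * (1 + (1 + 5 * x) * (1 + (1 + 5 * x) * (1 + (1 + 5 * x) * 0))))
    ≡ 5 * (1 + 5 * (2 * x + 10 * (x * x) + 25 * (x * x * x) + 25 * (x * x * x * x)))
  expand = ℕ-Ring.solve-∀

prime∤power : ∀ {p q} → Prime p → Prime q → p ≢ q → ∀ i → ¬ p ∣ q ^ i
prime∤power pp pq p≢q zero    p∣1 = contradiction (subst Prime (ℕ.∣1⇒≡1 p∣1) pp) (from-no (prime? 1))
prime∤power {q = q} pp pq p≢q (suc i) d with euclidsLemma q (q ^ i) pp d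
... | inj₂ d′ = prime∤power pp pq p≢q i d′
... | inj₁ p∣q with prime⇒irreducible pq p∣q
... | inj₁ refl = contradiction pp (from-no (prime? 1))
... | inj₂ p≡q = p≢q p≡q

remainder : ∀ k .{{_ : NonZero k}} n → ∃₂ λ r d → r < k × n ≡ r + k * d
remainder k n = n ℕ.% k , n ℕ./ k , ℕ.m%n<n n k ,
  trans (ℕ.m≡m%n+[m/n]*n n k) (cong (λ x → n ℕ.% k + x) (ℕ.*-comm (n ℕ./ k) k))

∣-minus-sym : ∀ {m} a b → m ℤ.∣ a ℤ.- b → m ℤ.∣ b ℤ.- a
∣-minus-sym {m} a b d = subst (m ℤ.∣_) (flip a b) (ℤ.∣m⇒∣-m d)
  where
  flip : ∀ a b → ℤ.- (a ℤ.- b) ≡ b ℤ.- a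
  flip = ℤ-Ring.solve-∀

∣-minus-trans : ∀ {m} a b c → m ℤ.∣ a ℤ.- b → m ℤ.∣ b ℤ.- c → m ℤ.∣ a ℤ.- c
∣-minus-trans {m} a b c d e = subst (m ℤ.∣_) (telescope a b c) (ℤ.∣m∣n⇒∣m+n d e)
  where
  telescope : ∀ a b c → (a ℤ.- b) ℤ.+ (b ℤ.- c) ≡ a ℤ.- c
  telescope = ℤ-Ring.solve-∀

-- Powers of 2 and of 5 discriminate

ordered-discriminates : ∀ {n m} →
  (∀ i δ → 1 ≤ i → i + δ ≤ n → + m ℤ.∣ u (i + δ) ℤ.- u i → δ ≡ 0) → Discriminates n m
ordered-discriminates {n} {m} separated i j 1≤i i≤n 1≤j j≤n d with ℕ.≤-total i j
... | inj₁ i≤j with δ , refl ← ℕ.m≤n⇒∃[o]m+o≡n i≤j =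
  sym (trans (cong (λ x → i + x) (separated i δ 1≤i j≤n (∣-minus-sym (u i) (u (i + δ)) (∣ᵤ⇒∣ d)))) (ℕ.+-identityʳ i))
... | inj₂ j≤i with δ , refl ← ℕ.m≤n⇒∃[o]m+o≡n j≤i =
  trans (cong (λ x → j + x) (separated j δ 1≤j i≤n (∣ᵤ⇒∣ d))) (ℕ.+-identityʳ j)

u-periodic : ∀ {m} i d → m ∣ 2 * 3 ^ i * rep 8 d → + m ℤ.∣ u (i + 2 * d) ℤ.- u i
u-periodic {m} i d h = subst (+ m ℤ.∣_) (sym (u-shift i d)) (∣ᵤ⇒∣ h)

u-periodic⁻¹ : ∀ {m} i d → + m ℤ.∣ u (i + 2 * d) ℤ.- u i → m ∣ 2 * 3 ^ i * rep 8 d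
u-periodic⁻¹ {m} i d h = ∣⇒∣ᵤ (subst (+ m ℤ.∣_) (u-shift i d) h)

∣sgn∣≡1 : ∀ i → ∣ sgn i ∣ ≡ 1
∣sgn∣≡1 zero    = refl
∣sgn∣≡1 (suc i) = trans (ℤ.∣-i∣≡∣i∣ (sgn i)) (∣sgn∣≡1 i)

-- By the recurrence the difference is 2 u i ± 5, which is odd.
u-parity : ∀ i → ¬ + 2 ℤ.∣ u (suc i) ℤ.- u i
u-parity i d = contradiction
  (subst (2 ∣_) (trans (ℤ.abs-* (+ 5) (sgn i)) (cong (5 *_) (∣sgn∣≡1 i)))
    (∣⇒∣ᵤ (ℤ.∣m+n∣m⇒∣n (subst (+ 2 ℤ.∣_) (trans (cong (ℤ._- u i) (u-step i)) (split (u i) (sgn i))) d)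
      (ℤ.∣m⇒∣m*n (u i) ℤ.∣-refl))))
  (from-no (2 ∣? 5))
  where
  split : ∀ x s → + 3 ℤ.* x ℤ.+ + 5 ℤ.* s ℤ.- x ≡ + 2 ℤ.* x ℤ.+ + 5 ℤ.* s
  split = ℤ-Ring.solve-∀

∣∧<⇒≡0 : ∀ {m n} → m ∣ n → n < m → n ≡ 0
∣∧<⇒≡0 {n = zero}  _ _   = refl
∣∧<⇒≡0 {n = suc _} d n<m = contradiction d (ℕ.>⇒∤ n<m)

positive-sum< : ∀ {i δ n} → 1 ≤ i → i + δ ≤ n → δ < n
positive-sum< {i} 1≤i i+δ≤n = ℕ.≤-trans (ℕ.+-monoˡ-≤ _ 1≤i) i+δ≤n

2^-discriminates : ∀ {n} e → n ≤ 2 ^ e → Discriminates n (2 ^ e)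
2^-discriminates zero n≤1 = ordered-discriminates λ i δ 1≤i i+δ≤n _ →
  ℕ.n≤0⇒n≡0 (ℕ.≤-pred (ℕ.≤-trans (positive-sum< 1≤i i+δ≤n) n≤1))
2^-discriminates {n} (suc e) n≤2^e = ordered-discriminates separated
  where
  separated : ∀ i δ → 1 ≤ i → i + δ ≤ n → + (2 ^ suc e) ℤ.∣ u (i + δ) ℤ.- u i → δ ≡ 0
  separated i δ 1≤i i+δ≤n h with remainder 2 δ
  ... | 0 , d , _ , refl = ∣∧<⇒≡0 (ℕ.*-monoʳ-∣ 2 2^e∣d) (ℕ.<-≤-trans (positive-sum< 1≤i i+δ≤n) n≤2^e)
    where
    swap : ∀ x y → 2 * x * y ≡ 2 * (y * x)
    swap = ℕ-Ring.solve-∀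
    2^e∣d : 2 ^ e ∣ d
    2^e∣d = 2^∣rep e d (prime-power-cancel prime[2] e (prime∤power prime[2] prime[3] (λ ()) i)
      (ℕ.*-cancelˡ-∣ 2 (subst (2 ^ suc e ∣_) (swap (3 ^ i) (rep 8 d)) (u-periodic⁻¹ i d h))))
  -- An odd gap is refuted mod 2 already: there the sequence has period 2, so two consecutive terms
  -- would agree.
  ... | 1 , d , _ , refl = contradiction (∣-minus-trans (u (suc i)) (u (suc i + 2 * d)) (u i)
      (∣-minus-sym (u (suc i + 2 * d)) (u (suc i)) (u-periodic (suc i) d (ℕ.∣m⇒∣m*n (rep 8 d) (ℕ.m∣m*n (3 ^ suc i)))))
      (ℤ.∣-trans (∣ᵤ⇒∣ (ℕ.m∣m*n {2} (2 ^ e))) (subst (λ k → + (2 ^ suc e) ℤ.∣ u k ℤ.- u i) (ℕ.+-suc i (2 * d)) h)))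
      (u-parity i)
  ... | suc (suc _) , _ , s≤s (s≤s ()) , _

4u≡3^mod5 : ∀ i → + 5 ℤ.∣ u i ℤ.* + 4 ℤ.- + (3 ^ i)
4u≡3^mod5 i = subst (+ 5 ℤ.∣_) (sym (trans (cong (ℤ._- + (3 ^ i)) (u-closed i)) (cancel (+ (3 ^ i)) (sgn i))))
  (ℤ.∣m⇒∣m*n (ℤ.- sgn i) ℤ.∣-refl)
  where
  cancel : ∀ t s → t ℤ.- + 5 ℤ.* s ℤ.- t ≡ + 5 ℤ.* (ℤ.- s)
  cancel = ℤ-Ring.solve-∀

-- Modulo 5 the alternating summand vanishes and 4 u i is just 3^i. Since 3 has order 4 mod 5, gaps
-- of collisions will have to be multiples of 4.
5∣u-diff : ∀ i r → + 5 ℤ.∣ u (i + r) ℤ.- u i → 5 ∣ ∣ + (3 ^ r) ℤ.- + 1 ∣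
5∣u-diff i r h = cancel-3^i (euclidsLemma (∣ + (3 ^ r) ℤ.- + 1 ∣) (3 ^ i) prime[5]
  (subst (5 ∣_) (ℤ.abs-* (+ (3 ^ r) ℤ.- + 1) (+ (3 ^ i))) (∣⇒∣ᵤ (subst (+ 5 ℤ.∣_) factored 5∣3^-diff))))
  where
  cancel-3^i : (5 ∣ (∣ + (3 ^ r) ℤ.- + 1 ∣)) ⊎ (5 ∣ (3 ^ i)) → 5 ∣ (∣ + (3 ^ r) ℤ.- + 1 ∣)
  cancel-3^i (inj₁ d) = d
  cancel-3^i (inj₂ d) = contradiction d (prime∤power prime[5] prime[3] (λ ()) i)
  scale : ∀ x y → (x ℤ.- y) ℤ.* + 4 ≡ x ℤ.* + 4 ℤ.- y ℤ.* + 4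
  scale = ℤ-Ring.solve-∀
  factor : ∀ t x → t ℤ.* x ℤ.- t ≡ (x ℤ.- + 1) ℤ.* t
  factor = ℤ-Ring.solve-∀
  factored : + (3 ^ (i + r)) ℤ.- + (3 ^ i) ≡ (+ (3 ^ r) ℤ.- + 1) ℤ.* + (3 ^ i)
  factored = trans (cong (ℤ._- + (3 ^ i)) (trans (cong +_ (ℕ.^-distribˡ-+-* 3 i r)) (ℤ.pos-* (3 ^ i) (3 ^ r))))
    (factor (+ (3 ^ i)) (+ (3 ^ r)))
  5∣3^-diff : + 5 ℤ.∣ + (3 ^ (i + r)) ℤ.- + (3 ^ i)
  5∣3^-diff = ∣-minus-trans (+ (3 ^ (i + r))) (u (i + r) ℤ.* + 4) (+ (3 ^ i))
    (∣-minus-sym (u (i + r) ℤ.* + 4) (+ (3 ^ (i + r))) (4u≡3^mod5 (i + r)))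
    (∣-minus-trans (u (i + r) ℤ.* + 4) (u i ℤ.* + 4) (+ (3 ^ i))
      (subst (+ 5 ℤ.∣_) (scale (u (i + r)) (u i)) (ℤ.∣m⇒∣m*n (+ 4) h))
      (4u≡3^mod5 i))

-- Here 10 = (9² - 1) / 8 and 81 = 1 + 80. The factor 5 of this 10 is why divisibility by
-- `5 ^ suc f` yields only `5 ^ f ∣ d` for a gap 4 d.
rep-8-double : ∀ d → rep 8 (2 * d) ≡ 10 * rep 80 d
rep-8-double d = trans (cong (rep 8) (ℕ.*-comm 2 d)) (rep-* 8 d 2)

5^-discriminates : ∀ {n} f → n ≤ 4 * 5 ^ f → Discriminates n (5 ^ suc f)
5^-discriminates {n} f n≤4*5^f = ordered-discriminates separated
  where
  4*≡2*2* : ∀ i d → i + 4 * d ≡ i + 2 * (2 * d)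
  4*≡2*2* = ℕ-Ring.solve-∀
  swap : ∀ t r → 2 * t * (10 * r) ≡ 5 * (r * 4 * t)
  swap = ℕ-Ring.solve-∀
  gap : ∀ i r d → i + (r + 4 * d) ≡ (i + r) + 2 * (2 * d)
  gap = ℕ-Ring.solve-∀
  u-shift-4 : ∀ i d → 2 * 3 ^ i * rep 8 (2 * d) ≡ 5 * (rep 80 d * 4 * 3 ^ i)
  u-shift-4 i d = trans (cong (2 * 3 ^ i *_) (rep-8-double d)) (swap (3 ^ i) (rep 80 d))
  same-class : ∀ i r d → + (5 ^ suc f) ℤ.∣ u (i + (r + 4 * d)) ℤ.- u i → 5 ∣ ∣ + (3 ^ r) ℤ.- + 1 ∣
  same-class i r d h = 5∣u-diff i r (∣-minus-trans (u (i + r)) (u ((i + r) + 2 * (2 * d))) (u i)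
    (∣-minus-sym (u ((i + r) + 2 * (2 * d))) (u (i + r))
      (u-periodic (i + r) (2 * d) (subst (5 ∣_) (sym (u-shift-4 (i + r) d)) (ℕ.m∣m*n (rep 80 d * 4 * 3 ^ (i + r))))))
    (ℤ.∣-trans (∣ᵤ⇒∣ (ℕ.m∣m*n {5} (5 ^ f))) (subst (λ k → + (5 ^ suc f) ℤ.∣ u k ℤ.- u i) (gap i r d) h)))
  separated : ∀ i δ → 1 ≤ i → i + δ ≤ n → + (5 ^ suc f) ℤ.∣ u (i + δ) ℤ.- u i → δ ≡ 0
  separated i δ 1≤i i+δ≤n h with remainder 4 δ
  ... | 0 , d , _ , refl = ∣∧<⇒≡0 (ℕ.*-monoʳ-∣ 4 5^f∣d) (ℕ.<-≤-trans (positive-sum< 1≤i i+δ≤n) n≤4*5^f)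
    where
    5^f∣d : 5 ^ f ∣ d
    5^f∣d = 5^∣rep f d (prime-power-cancel prime[5] f (from-no (5 ∣? 4)) (prime-power-cancel prime[5] f (prime∤power prime[5] prime[3] (λ ()) i)
      (ℕ.*-cancelˡ-∣ 5 (subst (5 ^ suc f ∣_) (u-shift-4 i d)
        (u-periodic⁻¹ i (2 * d) (subst (λ k → + (5 ^ suc f) ℤ.∣ u k ℤ.- u i) (4*≡2*2* i d) h))))))
  -- The numbers 2, 8 and 26 are 3^r - 1 for r = 1, 2, 3.
  ... | 1 , d , _ , refl = contradiction (same-class i 1 d h) (from-no (5 ∣? 2))
  ... | 2 , d , _ , refl = contradiction (same-class i 2 d h) (from-no (5 ∣? 8))
  ... | 3 , d , _ , refl = contradiction (same-class i 3 d h) (from-no (5 ∣? 26))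
  ... | suc (suc (suc (suc _))) , _ , s≤s (s≤s (s≤s (s≤s ()))) , _

n≤2^⌈log₂n⌉ : ∀ n → n ≤ 2 ^ ⌈log₂ n ⌉
n≤2^⌈log₂n⌉ = <-rec _ bound
  where
  bound : ∀ n → (∀ {k} → k < n → k ≤ 2 ^ ⌈log₂ k ⌉) → n ≤ 2 ^ ⌈log₂ n ⌉
  bound 0 _ = z≤n
  bound 1 _ = s≤s z≤n
  bound n@(suc (suc k)) rec = begin
    n                             ≡⟨ ℕ.⌊n/2⌋+⌈n/2⌉≡n n ⟨
    ⌊ n /2⌋ + ⌈ n /2⌉             ≤⟨ ℕ.+-monoˡ-≤ ⌈ n /2⌉ (ℕ.⌊n/2⌋≤⌈n/2⌉ n) ⟩
    ⌈ n /2⌉ + ⌈ n /2⌉             ≡⟨ cong (λ x → ⌈ n /2⌉ + x) (ℕ.+-identityʳ ⌈ n /2⌉) ⟨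
    2 * ⌈ n /2⌉                   ≤⟨ ℕ.*-monoʳ-≤ 2 (rec (ℕ.⌈n/2⌉<n k)) ⟩
    2 ^ suc ⌈log₂ ⌈ n /2⌉ ⌉       ≡⟨ cong (λ e → 2 ^ suc e) (⌈log₂⌈n/2⌉⌉≡⌈log₂n⌉∸1 n) ⟩
    2 ^ suc (⌈log₂ n ⌉ ∸ 1)       ≡⟨ cong (2 ^_) (ℕ.m+[n∸m]≡n (⌈log₂⌉-mono-≤ {2} {n} (s≤s (s≤s z≤n)))) ⟩
    2 ^ ⌈log₂ n ⌉                 ∎
    where open ℕ.≤-Reasoning

-- Collisions from periodicity

∣-rep-* : ∀ {m} x t s → m ∣ x * rep 8 t → m ∣ x * rep 8 (s * t)
∣-rep-* {m} x t s d = subst (m ∣_) (trans (ℕ.*-assoc x (rep 8 t) _) (cong (x *_) (sym (rep-* 8 s t))))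
  (ℕ.∣m⇒∣m*n (rep (8 * rep 8 t) s) d)

-- The divisibility makes 2 t a period mod d on the progression starting at i, so the q + 1 terms at
-- i + 2 t s with s ≤ q share a class mod d: one too many. A larger i raises the power of 3, which
-- moduli divisible by 9 require.
period-¬discriminates : ∀ {n} d q i t .{{_ : NonZero q}} .{{_ : NonZero t}} → 1 ≤ i → i + 2 * (q * t) ≤ n →
  d ∣ 2 * 3 ^ i * rep 8 t → ¬ Discriminates n (d * q)
period-¬discriminates {n} d q i t 1≤i bound d∣ =
  crowded-class d q (u i) f
    (λ s → ℕ.≤-trans 1≤i (ℕ.m≤m+n i _) ,
           ℕ.≤-trans (ℕ.+-monoʳ-≤ i (ℕ.*-monoʳ-≤ 2 (ℕ.*-monoˡ-≤ t (ℕ.≤-pred (Fin.toℕ<n s))))) bound)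
    (λ {s} {s′} eq → Fin.toℕ-injective (ℕ.*-cancelʳ-≡ (toℕ s) (toℕ s′) t (ℕ.*-cancelˡ-≡ (toℕ s * t) (toℕ s′ * t) 2 (ℕ.+-cancelˡ-≡ i _ _ eq))))
    (λ s → u-periodic i (toℕ s * t) (∣-rep-* (2 * 3 ^ i) t (toℕ s) d∣))
  where
  f : Fin (suc q) → ℕ
  f s = i + 2 * (toℕ s * t)

-- Incidences of points and lines over F_p

sum-mono : ∀ {n} {f g : Fin n → ℕ} → (∀ i → f i ≤ g i) → sum f ≤ sum g
sum-mono {zero}  f≤g = z≤n
sum-mono {suc n} f≤g = ℕ.+-mono-≤ (f≤g zero) (sum-mono (f≤g ∘ suc))

sum-const : ∀ n c → sum {n} (λ _ → c) ≡ n * c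
sum-const zero    c = refl
sum-const (suc n) c = cong (λ x → c + x) (sum-const n c)

sum-0 : ∀ {n} {f : Fin n → ℕ} → (∀ i → f i ≡ 0) → sum f ≡ 0
sum-0 {n} f≡0 = trans (sum-cong-≗ f≡0) (trans (sum-const n 0) (ℕ.*-zeroʳ n))

term≤sum : ∀ {n} (f : Fin n → ℕ) i → f i ≤ sum f
term≤sum f zero    = ℕ.m≤m+n _ _
term≤sum f (suc i) = ℕ.≤-trans (term≤sum (f ∘ suc) i) (ℕ.m≤n+m _ _)

𝟙 : ∀ {P : Set} → Dec P → ℕ
𝟙 (yes _) = 1
𝟙 (no  _) = 0

𝟙-yes : ∀ {P : Set} (P? : Dec P) → P → 𝟙 P? ≡ 1
𝟙-yes (yes _) _ = refl
𝟙-yes (no ¬p) p = contradiction p ¬p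

𝟙-no : ∀ {P : Set} (P? : Dec P) → ¬ P → 𝟙 P? ≡ 0
𝟙-no (yes p) ¬p = contradiction p ¬p
𝟙-no (no _)  _  = refl

𝟙*𝟙≤𝟙 : ∀ {P Q : Set} (P? : Dec P) (Q? : Dec Q) → 𝟙 P? * 𝟙 Q? ≤ 𝟙 P?
𝟙*𝟙≤𝟙 (yes _) (yes _) = s≤s z≤n
𝟙*𝟙≤𝟙 (yes _) (no _)  = z≤n
𝟙*𝟙≤𝟙 (no _)  _       = z≤n

count≤1 : ∀ {n} {P : Fin n → Set} (P? : ∀ i → Dec (P i)) → (∀ i j → P i → P j → i ≡ j) → sum (λ i → 𝟙 (P? i)) ≤ 1
count≤1 {zero}  P? unique = z≤n
count≤1 {suc n} P? unique with P? zero
... | no _  = count≤1 (P? ∘ suc) (λ i j p q → Fin.suc-injective (unique (suc i) (suc j) p q))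
... | yes p = ℕ.≤-reflexive (cong suc (sum-0 λ j → 𝟙-no (P? (suc j)) λ q → contradiction (unique zero (suc j) p q) λ ()))

-- Each f (g i) is spread over the targets a by the indicator of g i = a; after exchanging the sums,
-- injectivity lets every a count at most once.
sum-injection : ∀ {m n} (f : Fin n → ℕ) (g : Fin m → Fin n) → (∀ {i j} → g i ≡ g j → i ≡ j) → sum (f ∘ g) ≤ sum f
sum-injection f g g-inj = begin
  sum (λ i → f (g i))                             ≤⟨ sum-mono pick ⟩
  sum (λ i → sum (λ a → 𝟙 (g i Fin.≟ a) * f a))   ≡⟨ ∑-comm (λ i a → 𝟙 (g i Fin.≟ a) * f a) ⟩
  sum (λ a → sum (λ i → 𝟙 (g i Fin.≟ a) * f a))   ≡⟨ sum-cong-≗ (λ a → sym (*-distribʳ-sum (f a) (λ i → 𝟙 (g i Fin.≟ a)))) ⟩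
  sum (λ a → sum (λ i → 𝟙 (g i Fin.≟ a)) * f a)   ≤⟨ sum-mono (λ a → ℕ.*-monoˡ-≤ (f a) (count≤1 (λ i → g i Fin.≟ a) λ i j p q → g-inj (trans p (sym q)))) ⟩
  sum (λ a → 1 * f a)                             ≡⟨ sum-cong-≗ (λ a → ℕ.*-identityˡ (f a)) ⟩
  sum f                                           ∎
  where
  open ℕ.≤-Reasoning
  pick : ∀ i → f (g i) ≤ sum (λ a → 𝟙 (g i Fin.≟ a) * f a)
  pick i = begin
    f (g i)                               ≡⟨ ℕ.*-identityˡ (f (g i)) ⟨
    1 * f (g i)                           ≡⟨ cong (_* f (g i)) (𝟙-yes (g i Fin.≟ g i) refl) ⟨
    𝟙 (g i Fin.≟ g i) * f (g i)           ≤⟨ term≤sum (λ a → 𝟙 (g i Fin.≟ a) * f a) (g i) ⟩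
    sum (λ a → 𝟙 (g i Fin.≟ a) * f a)     ∎

sum² : ∀ {m n} → (Fin m → Fin n → ℕ) → ℕ
sum² f = sum (λ a → sum (f a))

sum²-mono : ∀ {m n} {f g : Fin m → Fin n → ℕ} → (∀ a b → f a b ≤ g a b) → sum² f ≤ sum² g
sum²-mono f≤g = sum-mono λ a → sum-mono (f≤g a)

sum²-+ : ∀ {m n} (f g : Fin m → Fin n → ℕ) → sum² (λ a b → f a b + g a b) ≡ sum² f + sum² g
sum²-+ f g = trans (sum-cong-≗ λ a → ∑-distrib-+ (f a) (g a)) (∑-distrib-+ (λ a → sum (f a)) (λ a → sum (g a)))

sum²-* : ∀ {m n} c (f : Fin m → Fin n → ℕ) → sum² (λ a b → c * f a b) ≡ c * sum² f
sum²-* c f = trans (sum-cong-≗ λ a → sym (*-distribˡ-sum c (f a))) (sym (*-distribˡ-sum c (λ a → sum (f a))))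

sum²-const : ∀ m n c → sum² {m} {n} (λ _ _ → c) ≡ m * (n * c)
sum²-const m n c = trans (sum-cong-≗ {m} λ _ → sum-const n c) (sum-const m (n * c))

sum²-comm : ∀ {k m n} (f : Fin k → Fin m → Fin n → ℕ) →
  sum² (λ a b → sum (λ s → f s a b)) ≡ sum (λ s → sum² (f s))
sum²-comm f = trans (sum-cong-≗ λ a → ∑-comm (λ b s → f s a b)) (∑-comm (λ a s → sum (f s a)))

sum-*-sum : ∀ {n} (f : Fin n → ℕ) → sum f * sum f ≡ sum² (λ s t → f s * f t)
sum-*-sum f = trans (*-distribʳ-sum (sum f) f) (sum-cong-≗ λ s → *-distribˡ-sum (f s) f)

2xy≤x²+y² : ∀ x y → 2 * (x * y) ≤ x * x + y * y
2xy≤x²+y² x y with ℕ.≤-total x y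
... | inj₁ x≤y with d , refl ← ℕ.m≤n⇒∃[o]m+o≡n x≤y = ℕ.≤-trans (ℕ.m≤m+n _ (d * d)) (ℕ.≤-reflexive (square x d))
  where
  square : ∀ x d → 2 * (x * (x + d)) + d * d ≡ x * x + (x + d) * (x + d)
  square = ℕ-Ring.solve-∀
... | inj₂ y≤x with d , refl ← ℕ.m≤n⇒∃[o]m+o≡n y≤x = ℕ.≤-trans (ℕ.m≤m+n _ (d * d)) (ℕ.≤-reflexive (square y d))
  where
  square : ∀ y d → 2 * ((y + d) * y) + d * d ≡ (y + d) * (y + d) + y * y
  square = ℕ-Ring.solve-∀

∣-residue : ∀ q .{{_ : NonZero q}} z → + q ℤ.∣ z ℤ.- + toℕ (residue q z)
∣-residue q z = ℤ.divides (z ℤ./ℕ q) (begin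
  z ℤ.- + toℕ (residue q z)                               ≡⟨ cong (λ r → z ℤ.- + r) (Fin.toℕ-fromℕ< (ℤ.n%ℕd<d z q)) ⟩
  z ℤ.- + (z ℤ.%ℕ q)                                       ≡⟨ cong (ℤ._- + (z ℤ.%ℕ q)) (ℤ.a≡a%ℕn+[a/ℕn]*n z q) ⟩
  + (z ℤ.%ℕ q) ℤ.+ (z ℤ./ℕ q) ℤ.* + q ℤ.- + (z ℤ.%ℕ q)       ≡⟨ cancel (+ (z ℤ.%ℕ q)) ((z ℤ./ℕ q) ℤ.* + q) ⟩
  (z ℤ./ℕ q) ℤ.* + q                                       ∎)
  where
  open ≡-Reasoning
  cancel : ∀ r y → r ℤ.+ y ℤ.- r ≡ y
  cancel = ℤ-Ring.solve-∀

residues-equal : ∀ {q} (a b : Fin q) → + q ℤ.∣ + toℕ a ℤ.- + toℕ b → a ≡ b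
residues-equal a b d = Fin.toℕ-injective (ℤ.+-injective (ℤ.i-j≡0⇒i≡j _ _ (ℤ.∣i∣≡0⇒i≡0 (∣∧<⇒≡0 (∣⇒∣ᵤ d) (begin-strict
  ∣ + toℕ a ℤ.- + toℕ b ∣   ≡⟨ cong ∣_∣ (ℤ.m-n≡m⊖n (toℕ a) (toℕ b)) ⟩
  ∣ toℕ a ℤ.⊖ toℕ b ∣       ≤⟨ ℤ.∣m⊝n∣≤m⊔n (toℕ a) (toℕ b) ⟩
  toℕ a ℕ.⊔ toℕ b           <⟨ ℕ.⊔-lub (Fin.toℕ<n a) (Fin.toℕ<n b) ⟩
  _                         ∎)))))
  where open ℕ.≤-Reasoning

euclid-ℤ : ∀ {p} → Prime p → ∀ a b → + p ℤ.∣ a ℤ.* b → + p ℤ.∣ a ⊎ + p ℤ.∣ b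
euclid-ℤ {p} pp a b d with euclidsLemma (∣ a ∣) (∣ b ∣) pp (subst (p ∣_) (ℤ.abs-* a b) (∣⇒∣ᵤ d))
... | inj₁ e = inj₁ (∣ᵤ⇒∣ e)
... | inj₂ e = inj₂ (∣ᵤ⇒∣ e)

-- Second moment of the number of points on a line x = a y + b: distinct points share at most one such line.
module _ {p} (pp : Prime p) {n} (x y : Fin n → ℤ)
  (distinct : ∀ {s t} → + p ℤ.∣ x s ℤ.- x t → + p ℤ.∣ y s ℤ.- y t → s ≡ t) where

  private instance
    p≢0 : NonZero p
    p≢0 = prime⇒nonZero pp

  OnLine : Fin p → Fin p → Fin n → Set
  OnLine a b t = + p ℤ.∣ (x t ℤ.- + toℕ a ℤ.* y t) ℤ.- + toℕ b

  onLine? : ∀ a b t → Dec (OnLine a b t)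
  onLine? a b t = + p ℤ.∣? _

  #on : Fin p → Fin p → ℕ
  #on a b = sum λ t → 𝟙 (onLine? a b t)

  #missing : ℕ
  #missing = sum² λ a b → 𝟙 (#on a b ℕ.≟ 0)

  private
    unique-line : ∀ a t b b′ → OnLine a b t → OnLine a b′ t → b ≡ b′
    unique-line a t b b′ d d′ = residues-equal b b′
      (∣-minus-trans (+ toℕ b) z (+ toℕ b′) (∣-minus-sym z (+ toℕ b) d) d′)
      where z = x t ℤ.- + toℕ a ℤ.* y t

    Joins : Fin n → Fin n → Fin p → Set
    Joins s t a = + p ℤ.∣ (x s ℤ.- x t) ℤ.- + toℕ a ℤ.* (y s ℤ.- y t)

    joins? : ∀ s t a → Dec (Joins s t a)
    joins? s t a = + p ℤ.∣? _

    common⇒joins : ∀ s t a b → OnLine a b s → OnLine a b t → Joins s t a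
    common⇒joins s t a b d e = subst (+ p ℤ.∣_) (difference (x s) (y s) (x t) (y t) (+ toℕ a))
      (∣-minus-trans (x s ℤ.- + toℕ a ℤ.* y s) (+ toℕ b) (x t ℤ.- + toℕ a ℤ.* y t) d
        (∣-minus-sym (x t ℤ.- + toℕ a ℤ.* y t) (+ toℕ b) e))
      where
      difference : ∀ x y x′ y′ a → (x ℤ.- a ℤ.* y) ℤ.- (x′ ℤ.- a ℤ.* y′) ≡ (x ℤ.- x′) ℤ.- a ℤ.* (y ℤ.- y′)
      difference = ℤ-Ring.solve-∀

    unique-joint : ∀ {s t} → s ≢ t → ∀ a a′ → Joins s t a → Joins s t a′ → a ≡ a′
    unique-joint {s} {t} s≢t a a′ d d′ with euclid-ℤ pp (+ toℕ a ℤ.- + toℕ a′) (y s ℤ.- y t)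
      (subst (+ p ℤ.∣_) (difference (x s ℤ.- x t) (y s ℤ.- y t) (+ toℕ a) (+ toℕ a′)) (ℤ.∣m∣n⇒∣m-n d′ d))
      where
      difference : ∀ X Y a a′ → (X ℤ.- a′ ℤ.* Y) ℤ.- (X ℤ.- a ℤ.* Y) ≡ (a ℤ.- a′) ℤ.* Y
      difference = ℤ-Ring.solve-∀
    ... | inj₁ a≈a′ = residues-equal a a′ a≈a′
    -- Two points with equal y have no joining line of the form x = a y + b: any such relation would
    -- make their x agree as well.
    ... | inj₂ y≈ = contradiction (distinct (subst (+ p ℤ.∣_) (restore (x s ℤ.- x t) (+ toℕ a ℤ.* (y s ℤ.- y t)))
            (ℤ.∣m∣n⇒∣m+n d (ℤ.∣n⇒∣m*n (+ toℕ a) y≈))) y≈) s≢t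
      where
      restore : ∀ X Z → (X ℤ.- Z) ℤ.+ Z ≡ X
      restore = ℤ-Ring.solve-∀

    first-moment : p * n ≤ sum² #on
    first-moment = begin
      p * n                                                       ≡⟨ cong (p *_) (ℕ.*-identityʳ n) ⟨
      p * (n * 1)                                                 ≡⟨ sum²-const p n 1 ⟨
      sum² {p} {n} (λ a t → 1)                                    ≤⟨ sum²-mono line-exists ⟩
      sum (λ a → sum (λ t → sum (λ b → 𝟙 (onLine? a b t))))       ≡⟨ sum-cong-≗ (λ a → ∑-comm (λ t b → 𝟙 (onLine? a b t))) ⟩
      sum² #on                                                    ∎
      where
      open ℕ.≤-Reasoning
      line-exists : ∀ a t → 1 ≤ sum (λ b → 𝟙 (onLine? a b t))
      line-exists a t = begin
        1                                  ≡⟨ 𝟙-yes (onLine? a b t) (∣-residue p (x t ℤ.- + toℕ a ℤ.* y t)) ⟨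
        𝟙 (onLine? a b t)                  ≤⟨ term≤sum (λ b → 𝟙 (onLine? a b t)) b ⟩
        sum (λ b → 𝟙 (onLine? a b t))      ∎
        where b = residue p (x t ℤ.- + toℕ a ℤ.* y t)

    lines≤1 : ∀ a s t → sum (λ b → 𝟙 (onLine? a b s) * 𝟙 (onLine? a b t)) ≤ 1
    lines≤1 a s t = ℕ.≤-trans (sum-mono λ b → 𝟙*𝟙≤𝟙 (onLine? a b s) (onLine? a b t))
      (count≤1 (λ b → onLine? a b s) (unique-line a s))

    lines≤joins : ∀ a s t → sum (λ b → 𝟙 (onLine? a b s) * 𝟙 (onLine? a b t)) ≤ 𝟙 (joins? s t a)
    lines≤joins a s t with joins? s t a
    ... | yes _ = lines≤1 a s t
    ... | no ¬j = ℕ.≤-reflexive (sum-0 disjoint)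
      where
      disjoint : ∀ b → 𝟙 (onLine? a b s) * 𝟙 (onLine? a b t) ≡ 0
      disjoint b with onLine? a b s | onLine? a b t
      ... | yes d | yes e = contradiction (common⇒joins s t a b d e) ¬j
      ... | yes _ | no _  = refl
      ... | no _  | _     = refl

    common-lines : ∀ s t → sum² (λ a b → 𝟙 (onLine? a b s) * 𝟙 (onLine? a b t)) ≤ 1 + p * 𝟙 (s Fin.≟ t)
    common-lines s t with s Fin.≟ t
    ... | yes _ = ℕ.≤-trans (sum-mono λ a → lines≤1 a s t) (ℕ.≤-trans (ℕ.≤-reflexive (sum-const p 1)) (ℕ.n≤1+n (p * 1)))
    ... | no s≢t = begin
      sum² (λ a b → 𝟙 (onLine? a b s) * 𝟙 (onLine? a b t)) ≤⟨ sum-mono (λ a → lines≤joins a s t) ⟩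
      sum (λ a → 𝟙 (joins? s t a))                         ≤⟨ count≤1 (joins? s t) (unique-joint s≢t) ⟩
      1                                                    ≤⟨ ℕ.m≤m+n 1 (p * 0) ⟩
      1 + p * 0                                            ∎
      where open ℕ.≤-Reasoning

    -- The sum counts ordered pairs of points with a common line. Each of the n² pairs contributes
    -- at most 1, and each of the n diagonal pairs at most a further p.
    second-moment : sum² (λ a b → #on a b * #on a b) ≤ n * (n + p)
    second-moment = begin
      sum² (λ a b → #on a b * #on a b)
        ≡⟨ sum-cong-≗ (λ a → sum-cong-≗ (λ b → sum-*-sum (λ t → 𝟙 (onLine? a b t)))) ⟩
      sum² (λ a b → sum² (λ s t → 𝟙 (onLine? a b s) * 𝟙 (onLine? a b t)))
        ≡⟨ sum²-comm (λ s a b → sum (λ t → 𝟙 (onLine? a b s) * 𝟙 (onLine? a b t))) ⟩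
      sum (λ s → sum² (λ a b → sum (λ t → 𝟙 (onLine? a b s) * 𝟙 (onLine? a b t))))
        ≡⟨ sum-cong-≗ (λ s → sum²-comm (λ t a b → 𝟙 (onLine? a b s) * 𝟙 (onLine? a b t))) ⟩
      sum² (λ s t → sum² (λ a b → 𝟙 (onLine? a b s) * 𝟙 (onLine? a b t)))
        ≤⟨ sum-mono (λ s → ℕ.≤-trans (sum-mono (common-lines s)) (row s)) ⟩
      sum {n} (λ s → n + p)
        ≡⟨ sum-const n (n + p) ⟩
      n * (n + p) ∎
      where
      open ℕ.≤-Reasoning
      row : ∀ s → sum (λ t → 1 + p * 𝟙 (s Fin.≟ t)) ≤ n + p
      row s = begin
        sum (λ t → 1 + p * 𝟙 (s Fin.≟ t))                   ≡⟨ ∑-distrib-+ (λ t → 1) (λ t → p * 𝟙 (s Fin.≟ t)) ⟩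
        sum {n} (λ t → 1) + sum (λ t → p * 𝟙 (s Fin.≟ t))   ≡⟨ cong₂ _+_ (trans (sum-const n 1) (ℕ.*-identityʳ n)) (sym (*-distribˡ-sum p (λ t → 𝟙 (s Fin.≟ t)))) ⟩
        n + p * sum (λ t → 𝟙 (s Fin.≟ t))                   ≤⟨ ℕ.+-monoʳ-≤ n (ℕ.*-monoʳ-≤ p (count≤1 (s Fin.≟_) (λ t t′ e e′ → trans (sym e) e′))) ⟩
        n + p * 1                                           ≡⟨ cong (λ z → n + z) (ℕ.*-identityʳ p) ⟩
        n + p                                               ∎

    -- This is (p r - n)² ≥ n² · [r = 0] without subtraction; n / p is the mean number of points on
    -- a line. The linear term stands on the left, so a lower bound on the first moment and an upper
    -- bound on the second suffice.
    pointwise : ∀ r → 2 * (p * n) * r + n * n * 𝟙 (r ℕ.≟ 0) ≤ p * p * (r * r) + n * n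
    pointwise zero = ℕ.≤-reflexive (atZero p n)
      where
      atZero : ∀ p n → 2 * (p * n) * 0 + n * n * 1 ≡ p * p * (0 * 0) + n * n
      atZero = ℕ-Ring.solve-∀
    pointwise r@(suc _) = begin
      2 * (p * n) * r + n * n * 0      ≡⟨ left p n r ⟩
      2 * ((p * r) * n)                ≤⟨ 2xy≤x²+y² (p * r) n ⟩
      (p * r) * (p * r) + n * n        ≡⟨ right p n r ⟩
      p * p * (r * r) + n * n          ∎
      where
      open ℕ.≤-Reasoning
      left : ∀ p n r → 2 * (p * n) * r + n * n * 0 ≡ 2 * ((p * r) * n)
      left = ℕ-Ring.solve-∀
      right : ∀ p n r → (p * r) * (p * r) + n * n ≡ p * p * (r * r) + n * n
      right = ℕ-Ring.solve-∀

  -- Chebyshev's inequality: when `pointwise` is summed over all p² lines, the terms 2 p² n² cancel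
  -- and n² Z ≤ n p³ remains.
  missing-bound : .{{NonZero n}} → n * #missing ≤ p * p * p
  missing-bound = ℕ.*-cancelˡ-≤ n (ℕ.+-cancelˡ-≤ (2 * (p * n) * (p * n)) _ _ (begin
    2 * (p * n) * (p * n) + n * (n * Z)
      ≤⟨ ℕ.+-monoˡ-≤ (n * (n * Z)) (ℕ.*-monoʳ-≤ (2 * (p * n)) first-moment) ⟩
    2 * (p * n) * sum² #on + n * (n * Z)
      ≡⟨ cong (λ z → 2 * (p * n) * sum² #on + z) (ℕ.*-assoc n n Z) ⟨
    2 * (p * n) * sum² #on + n * n * Z
      ≡⟨ cong₂ _+_ (sum²-* (2 * (p * n)) #on) (sum²-* (n * n) (λ a b → 𝟙 (#on a b ℕ.≟ 0))) ⟨
    sum² (λ a b → 2 * (p * n) * #on a b) + sum² (λ a b → n * n * 𝟙 (#on a b ℕ.≟ 0))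
      ≡⟨ sum²-+ (λ a b → 2 * (p * n) * #on a b) (λ a b → n * n * 𝟙 (#on a b ℕ.≟ 0)) ⟨
    sum² (λ a b → 2 * (p * n) * #on a b + n * n * 𝟙 (#on a b ℕ.≟ 0))
      ≤⟨ sum²-mono (λ a b → pointwise (#on a b)) ⟩
    sum² (λ a b → p * p * (#on a b * #on a b) + n * n)
      ≡⟨ sum²-+ (λ a b → p * p * (#on a b * #on a b)) (λ _ _ → n * n) ⟩
    sum² (λ a b → p * p * (#on a b * #on a b)) + sum² {p} {p} (λ _ _ → n * n)
      ≡⟨ cong₂ _+_ (sum²-* (p * p) (λ a b → #on a b * #on a b)) (sum²-const p p (n * n)) ⟩
    p * p * sum² (λ a b → #on a b * #on a b) + p * (p * (n * n))
      ≤⟨ ℕ.+-monoˡ-≤ (p * (p * (n * n))) (ℕ.*-monoʳ-≤ (p * p) second-moment) ⟩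
    p * p * (n * (n + p)) + p * (p * (n * n))
      ≡⟨ collect p n ⟩
    2 * (p * n) * (p * n) + n * (p * p * p) ∎))
    where
    open ℕ.≤-Reasoning
    Z = #missing
    collect : ∀ p n → p * p * (n * (n + p)) + p * (p * (n * n)) ≡ 2 * (p * n) * (p * n) + n * (p * p * p)
    collect = ℕ-Ring.solve-∀

-- Collisions modulo large primes

∤-* : ∀ {p} → Prime p → ∀ {a b} → ¬ + p ℤ.∣ a → + p ℤ.∣ a ℤ.* b → + p ℤ.∣ b
∤-* pp {a} {b} p∤a d with euclid-ℤ pp a b d
... | inj₁ e = contradiction e p∤a
... | inj₂ e = e

p∤small : ∀ {p} k .{{_ : NonZero k}} → k < p → ¬ + p ℤ.∣ + k
p∤small k k<p d = contradiction (∣⇒∣ᵤ d) (ℕ.>⇒∤ k<p)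

9^ : ℕ → ℤ
9^ i = + (9 ^ i)

9^-+ : ∀ i j → 9^ (i + j) ≡ 9^ i ℤ.* 9^ j
9^-+ i j = trans (cong +_ (ℕ.^-distribˡ-+-* 9 i j)) (ℤ.pos-* (9 ^ i) (9 ^ j))

9^-difference : ∀ i d → 9^ (i + d) ℤ.- 9^ i ≡ + (9 ^ i * (8 * rep 8 d))
9^-difference i d = begin
  9^ (i + d) ℤ.- 9^ i                          ≡⟨ cong (ℤ._- 9^ i) (9^-+ i d) ⟩
  9^ i ℤ.* + (9 ^ d) ℤ.- 9^ i                  ≡⟨ cong (λ x → 9^ i ℤ.* + x ℤ.- 9^ i) (suc-^ 8 d) ⟩
  9^ i ℤ.* + (1 + 8 * rep 8 d) ℤ.- 9^ i        ≡⟨ cong (λ x → 9^ i ℤ.* x ℤ.- 9^ i) (ℤ.pos-+ 1 (8 * rep 8 d)) ⟩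
  9^ i ℤ.* (+ 1 ℤ.+ + (8 * rep 8 d)) ℤ.- 9^ i  ≡⟨ factor (9^ i) (+ (8 * rep 8 d)) ⟩
  9^ i ℤ.* + (8 * rep 8 d)                     ≡⟨ ℤ.pos-* (9 ^ i) (8 * rep 8 d) ⟨
  + (9 ^ i * (8 * rep 8 d))                    ∎
  where
  open ≡-Reasoning
  factor : ∀ x y → x ℤ.* (+ 1 ℤ.+ y) ℤ.- x ≡ x ℤ.* y
  factor = ℤ-Ring.solve-∀

prime∤9^ : ∀ {p} → Prime p → 3 < p → ∀ i → ¬ p ∣ 9 ^ i
prime∤9^ {p} pp 3<p i d = prime∤power pp prime[3] (ℕ.>⇒≢ 3<p) (2 * i) (subst (p ∣_) (ℕ.^-*-assoc 3 2 i) d)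

9^-collision : ∀ {p} → Prime p → 3 < p → ∀ i d → + p ℤ.∣ 9^ (i + d) ℤ.- 9^ i → p ∣ rep 8 d
9^-collision {p} pp 3<p i d h
  with euclidsLemma (9 ^ i) (8 * rep 8 d) pp (∣⇒∣ᵤ (subst (+ p ℤ.∣_) (9^-difference i d) h))
... | inj₁ e = contradiction e (prime∤9^ pp 3<p i)
... | inj₂ e with euclidsLemma 8 (rep 8 d) pp e
... | inj₁ p∣8 = contradiction p∣8 (prime∤power pp prime[2] (ℕ.>⇒≢ (ℕ.<-trans (from-yes (2 ℕ.<? 3)) 3<p)) 3)
... | inj₂ p∣rep = p∣rep

even≢odd : ∀ a b → 2 * a ≢ 1 + 2 * b
even≢odd a b eq = contradiction (ℕ.∣m+n∣m⇒∣n {2} {2 * b} {1} (subst (2 ∣_) (trans eq (ℕ.+-comm 1 (2 * b))) (ℕ.m∣m*n a)) (ℕ.m∣m*n b)) (from-no (2 ∣? 1))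

module _ {p} (pp : Prime p) (10<p : 10 < p) {n} (disc : Discriminates n p) L .{{_ : NonZero L}} (4L≤2+n : 4 * L ≤ 2 + n) where

  private
    instance
      p≢0 : NonZero p
      p≢0 = prime⇒nonZero pp

    p∤ : ∀ k .{{_ : NonZero k}} → k ≤ 10 → ¬ + p ℤ.∣ + k
    p∤ k k≤10 = p∤small k (ℕ.≤-<-trans k≤10 10<p)

    3<p : 3 < p
    3<p = ℕ.<-trans (from-yes (3 ℕ.<? 10)) 10<p

    -- Otherwise u (1 + 2 d) would repeat u 1 inside the range.
    9^-ordered : ∀ i d → d < L → + p ℤ.∣ 9^ (i + d) ℤ.- 9^ i → d ≡ 0
    9^-ordered i d d<L h = ℕ.m+n≡0⇒m≡0 d (ℕ.+-cancelˡ-≡ 1 _ _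
      (disc (1 + 2 * d) 1 (s≤s z≤n) (bound d<L) ℕ.≤-refl (ℕ.≤-trans (s≤s z≤n) (bound d<L))
        (∣⇒∣ᵤ (u-periodic 1 d (ℕ.∣n⇒∣m*n 6 (9^-collision pp 3<p i d h))))))
      where
      bound : ∀ {d} → d < L → 1 + 2 * d ≤ n
      bound {d} d<L = ℕ.+-cancelˡ-≤ 2 _ _ (begin
        2 + (1 + 2 * d)  ≤⟨ ℕ.m≤m+n _ (1 + 2 * d) ⟩
        2 + (1 + 2 * d) + (1 + 2 * d) ≡⟨ double d ⟩
        4 * suc d        ≤⟨ ℕ.*-monoʳ-≤ 4 d<L ⟩
        4 * L            ≤⟨ 4L≤2+n ⟩
        2 + n            ∎)
        where
        open ℕ.≤-Reasoning
        double : ∀ d → 2 + (1 + 2 * d) + (1 + 2 * d) ≡ 4 * suc d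
        double = ℕ-Ring.solve-∀

    9^-injective : ∀ k (i j : Fin L) → + p ℤ.∣ 9^ (k + toℕ i) ℤ.- 9^ (k + toℕ j) → i ≡ j
    9^-injective k i j h = Fin.toℕ-injective (go (toℕ i) (toℕ j) (Fin.toℕ<n i) (Fin.toℕ<n j) h)
      where
      go : ∀ i j → i < L → j < L → + p ℤ.∣ 9^ (k + i) ℤ.- 9^ (k + j) → i ≡ j
      go i j i<L j<L h with ℕ.≤-total i j
      ... | inj₁ i≤j with d , refl ← ℕ.m≤n⇒∃[o]m+o≡n i≤j = sym (trans (cong (λ d → i + d)
              (9^-ordered (k + i) d (ℕ.≤-<-trans (ℕ.m≤n+m d i) j<L)
                (subst (λ x → + p ℤ.∣ 9^ x ℤ.- 9^ (k + i)) (sym (ℕ.+-assoc k i d)) (∣-minus-sym (9^ (k + i)) (9^ (k + (i + d))) h))))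
              (ℕ.+-identityʳ i))
      ... | inj₂ j≤i with d , refl ← ℕ.m≤n⇒∃[o]m+o≡n j≤i = trans (cong (λ d → j + d)
              (9^-ordered (k + j) d (ℕ.≤-<-trans (ℕ.m≤n+m d j) i<L)
                (subst (λ x → + p ℤ.∣ 9^ x ℤ.- 9^ (k + j)) (sym (ℕ.+-assoc k j d)) h)))
              (ℕ.+-identityʳ j)

    point : Fin (L * L) → Fin L × Fin L
    point = Fin.remQuot L

    -- The shift by L keeps the exponent L + i - l, left after division by 9^l with l < L, between 1
    -- and 2 L - 1. Exponent 0 would correspond to index 0, which lies outside the sequence.
    x y : Fin (L * L) → ℤ
    x t = 9^ (L + toℕ (proj₁ (point t)))
    y t = + 3 ℤ.* 9^ (toℕ (proj₂ (point t)))

    points-distinct : ∀ {s t} → + p ℤ.∣ x s ℤ.- x t → + p ℤ.∣ y s ℤ.- y t → s ≡ t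
    points-distinct {s} {t} dx dy = trans (sym (Fin.combine-remQuot {L} L s)) (trans (cong₂ Fin.combine
      (9^-injective L (proj₁ (point s)) (proj₁ (point t)) dx)
      (9^-injective 0 (proj₂ (point s)) (proj₂ (point t)) (∤-* pp (p∤ 3 (from-yes (3 ℕ.≤? 10)))
        (subst (+ p ℤ.∣_) (factor (9^ (toℕ (proj₂ (point s)))) (9^ (toℕ (proj₂ (point t))))) dy))))
      (Fin.combine-remQuot {L} L t))
      where
      factor : ∀ x y → + 3 ℤ.* x ℤ.- + 3 ℤ.* y ≡ + 3 ℤ.* (x ℤ.- y)
      factor = ℤ-Ring.solve-∀

    slope : Fin L → Fin L → Fin p
    slope l k = residue p (9^ (toℕ l + toℕ k))

    intercept : Fin L → Fin p
    intercept l = residue p (+ 10 ℤ.* 9^ (toℕ l))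

    slope-injective : ∀ l {k k′} → slope l k ≡ slope l k′ → k ≡ k′
    slope-injective l {k} {k′} eq = 9^-injective (toℕ l) k k′
      (residue-≡ p (9^ (toℕ l + toℕ k)) (9^ (toℕ l + toℕ k′)) eq)

    intercept-injective : ∀ {l l′} → intercept l ≡ intercept l′ → l ≡ l′
    intercept-injective {l} {l′} eq = 9^-injective 0 l l′ (∤-* pp (p∤ 10 ℕ.≤-refl)
      (subst (+ p ℤ.∣_) (factor (9^ (toℕ l)) (9^ (toℕ l′))) (residue-≡ p (+ 10 ℤ.* 9^ (toℕ l)) (+ 10 ℤ.* 9^ (toℕ l′)) eq)))
      where
      factor : ∀ x y → + 10 ℤ.* x ℤ.- + 10 ℤ.* y ≡ + 10 ℤ.* (x ℤ.- y)
      factor = ℤ-Ring.solve-∀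

    -- The largest indices that occur are 2 (2 L - 1) and 1 + 2 (2 L - 2); the condition 4 L ≤ 2 + n
    -- says that the first of them is at most n.
    opposite-distinct : ∀ a b → 1 ≤ a → a < 2 * L → b + 2 ≤ 2 * L → ¬ + p ℤ.∣ 9^ a ℤ.- (+ 3 ℤ.* 9^ b ℤ.+ + 10)
    opposite-distinct a b 1≤a a<2L b+2≤2L d = even≢odd a b
      (disc (2 * a) (1 + 2 * b) (ℕ.≤-trans 1≤a (ℕ.m≤m+n a _)) 2a≤n (s≤s z≤n) 1+2b≤n
        (∣⇒∣ᵤ (∤-* pp {+ 4} (p∤ 4 (from-yes (4 ℕ.≤? 10))) (subst (+ p ℤ.∣_) (trans (sym (u-opposite a b)) (ℤ.*-comm (u (2 * a) ℤ.- u (1 + 2 * b)) (+ 4))) d))))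
      where
      open ℕ.≤-Reasoning
      scale : ∀ a → 2 + 2 * a ≡ 2 * suc a
      scale = ℕ-Ring.solve-∀
      quadruple : ∀ L → 2 * (2 * L) ≡ 4 * L
      quadruple = ℕ-Ring.solve-∀
      offset : ∀ b → 2 + (1 + 2 * b) + 1 ≡ 2 * (b + 2)
      offset = ℕ-Ring.solve-∀
      2a≤n : 2 * a ≤ n
      2a≤n = ℕ.+-cancelˡ-≤ 2 _ _ (begin
        2 + 2 * a    ≡⟨ scale a ⟩
        2 * suc a    ≤⟨ ℕ.*-monoʳ-≤ 2 a<2L ⟩
        2 * (2 * L)  ≡⟨ quadruple L ⟩
        4 * L        ≤⟨ 4L≤2+n ⟩
        2 + n        ∎)
      1+2b≤n : 1 + 2 * b ≤ n
      1+2b≤n = ℕ.+-cancelˡ-≤ 2 _ _ (begin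
        2 + (1 + 2 * b)      ≤⟨ ℕ.m≤m+n _ 1 ⟩
        2 + (1 + 2 * b) + 1  ≡⟨ offset b ⟩
        2 * (b + 2)          ≤⟨ ℕ.*-monoʳ-≤ 2 b+2≤2L ⟩
        2 * (2 * L)          ≡⟨ quadruple L ⟩
        4 * L                ≤⟨ 4L≤2+n ⟩
        2 + n                ∎)

    -- Multiplying 9^(c+i) ≢ 3·9^(k+j) + 10 by 9^l, with L = l + c, gives L² lines without any of the points.
    line-missed : ∀ l k t → ¬ OnLine pp x y points-distinct (slope l k) (intercept l) t
    line-missed l k t onLine with c , l+c≡L ← ℕ.m≤n⇒∃[o]m+o≡n (ℕ.<⇒≤ (Fin.toℕ<n l)) =
      opposite-distinct (c + i) (toℕ k + j) 1≤c+i c+i<2L k+j+2≤2L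
        (∤-* pp {9^ (toℕ l)} (prime∤9^ pp 3<p (toℕ l) ∘ ∣⇒∣ᵤ) (subst (+ p ℤ.∣_) rescale
          (subst (+ p ℤ.∣_) (replace (x t) (y t) A (+ toℕ (slope l k)) B (+ toℕ (intercept l)))
            (ℤ.∣m∣n⇒∣m-n (ℤ.∣m∣n⇒∣m-n onLine (ℤ.∣m⇒∣m*n (y t) (∣-residue p A))) (∣-residue p B)))))
      where
      i j : ℕ
      i = toℕ (proj₁ (point t))
      j = toℕ (proj₂ (point t))
      A = 9^ (toℕ l + toℕ k)
      B = + 10 ℤ.* 9^ (toℕ l)
      i<L = Fin.toℕ<n (proj₁ (point t))
      j<L = Fin.toℕ<n (proj₂ (point t))
      open ℕ.≤-Reasoning
      1≤c+i : 1 ≤ c + i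
      1≤c+i = ℕ.≤-trans (ℕ.n≢0⇒n>0 λ { refl → ℕ.<⇒≢ (Fin.toℕ<n l) (trans (sym (ℕ.+-identityʳ _)) l+c≡L) }) (ℕ.m≤m+n c i)
      c+i<2L : c + i < 2 * L
      c+i<2L = begin-strict
        c + i       ≤⟨ ℕ.+-monoˡ-≤ i (ℕ.≤-trans (ℕ.m≤n+m c (toℕ l)) (ℕ.≤-reflexive l+c≡L)) ⟩
        L + i       <⟨ ℕ.+-monoʳ-< L i<L ⟩
        L + L       ≡⟨ cong (λ z → L + z) (ℕ.+-identityʳ L) ⟨
        2 * L       ∎
      k+j+2≤2L : toℕ k + j + 2 ≤ 2 * L
      k+j+2≤2L = begin
        toℕ k + j + 2        ≡⟨ regroup (toℕ k) j ⟩
        suc (toℕ k) + suc j  ≤⟨ ℕ.+-mono-≤ (Fin.toℕ<n k) j<L ⟩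
        L + L                ≡⟨ cong (λ z → L + z) (ℕ.+-identityʳ L) ⟨
        2 * L                ∎
        where
        regroup : ∀ k j → k + j + 2 ≡ suc k + suc j
        regroup = ℕ-Ring.solve-∀
      replace : ∀ x y A a B b → (((x ℤ.- a ℤ.* y) ℤ.- b) ℤ.- (A ℤ.- a) ℤ.* y) ℤ.- (B ℤ.- b) ≡ (x ℤ.- A ℤ.* y) ℤ.- B
      replace = ℤ-Ring.solve-∀
      factor : ∀ l c k j → (l ℤ.* c ℤ.- l ℤ.* k ℤ.* (+ 3 ℤ.* j)) ℤ.- + 10 ℤ.* l ≡ l ℤ.* (c ℤ.- (+ 3 ℤ.* (k ℤ.* j) ℤ.+ + 10))
      factor = ℤ-Ring.solve-∀
      rescale : (x t ℤ.- A ℤ.* y t) ℤ.- B ≡ 9^ (toℕ l) ℤ.* (9^ (c + i) ℤ.- (+ 3 ℤ.* 9^ (toℕ k + j) ℤ.+ + 10))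
      rescale = trans
        (cong (λ e → (9^ e ℤ.- A ℤ.* y t) ℤ.- B) (trans (cong (λ e → e + i) (sym l+c≡L)) (ℕ.+-assoc (toℕ l) c i)))
        (trans (cong₂ (λ X A → (X ℤ.- A ℤ.* y t) ℤ.- B) (9^-+ (toℕ l) (c + i)) (9^-+ (toℕ l) (toℕ k)))
        (trans (factor (9^ (toℕ l)) (9^ (c + i)) (9^ (toℕ k)) (9^ j))
        (cong (λ z → 9^ (toℕ l) ℤ.* (9^ (c + i) ℤ.- (+ 3 ℤ.* z ℤ.+ + 10))) (sym (9^-+ (toℕ k) j)))))

    miss : Fin p → Fin p → ℕ
    miss a b = 𝟙 (#on pp x y points-distinct a b ℕ.≟ 0)

    -- The L² lines are distinct: the intercept determines l, and for this l the slope determines k.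
    -- The two injections are applied one after the other, inner sum over slopes first.
    many-missing : L * L ≤ #missing pp x y points-distinct
    many-missing = begin
      L * L                                               ≡⟨ cong (L *_) (ℕ.*-identityʳ L) ⟨
      L * (L * 1)                                         ≡⟨ sum²-const L L 1 ⟨
      sum² {L} {L} (λ l k → 1)                            ≡⟨ sum-cong-≗ (λ l → sum-cong-≗ (λ k → sym (missed l k))) ⟩
      sum² (λ l k → miss (slope l k) (intercept l))       ≤⟨ sum-mono (λ l → sum-injection (λ a → miss a (intercept l)) (slope l) (slope-injective l)) ⟩
      sum (λ l → sum (λ a → miss a (intercept l)))        ≤⟨ sum-injection (λ b → sum (λ a → miss a b)) intercept intercept-injective ⟩
      sum (λ b → sum (λ a → miss a b))                    ≡⟨ ∑-comm (λ b a → miss a b) ⟩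
      sum² miss                                           ∎
      where
      open ℕ.≤-Reasoning
      missed : ∀ l k → miss (slope l k) (intercept l) ≡ 1
      missed l k = 𝟙-yes (#on pp x y points-distinct (slope l k) (intercept l) ℕ.≟ 0)
        (sum-0 λ t → 𝟙-no (onLine? pp x y points-distinct (slope l k) (intercept l) t) (line-missed l k t))

  L⁴≤p³ : L * L * (L * L) ≤ p * p * p
  L⁴≤p³ = ℕ.≤-trans (ℕ.*-monoʳ-≤ (L * L) many-missing) (missing-bound pp x y points-distinct {{ℕ.m*n≢0 L L}})

-- Collisions modulo small primes

step : (d a r : ℕ) .{{_ : NonZero d}} → ℕ
step d a r = (3 * r + a) ℕ.% d

member : ℕ → List ℕ → Bool
member r []       = false
member r (x ∷ xs) = (r ℕ.≡ᵇ x) ∨ member r xs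

-- At index j the arguments a, b, r stand mod d for 5 sgn j, 5 sgn (j + 1) and u j, and the list
-- holds the residues of the earlier terms. The first argument is the number of terms still to be
-- inspected.
repeats : ℕ → (d a b r : ℕ) .{{_ : NonZero d}} → List ℕ → Bool
repeats zero    d a b r seen = false
repeats (suc k) d a b r seen = member r seen ∨ repeats k d b a (step d a r) (r ∷ seen)

-- Composite moduli are skipped only to save time.
small-factor : ℕ → ℕ → ℕ → Bool
small-factor zero    q d = false
small-factor (suc k) q d = ((suc (suc q) ℕ.<ᵇ d) ∧ (d ℕ.% suc (suc q) ℕ.≡ᵇ 0)) ∨ small-factor k (suc q) d

-- The summand 5 sgn j of the recurrence alternates between the residues 5 k ≡ −5 and 5 modulo suc k.
repeats-early : ℕ → Bool
repeats-early zero        = true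
repeats-early d@(suc k)   = repeats (suc ⌊ d /2⌋) d (5 * k) 5 (2 ℕ.% d) []

all-checked : ℕ → ℕ → Bool
all-checked zero    d = true
all-checked (suc k) d = (small-factor 40 0 d ∨ repeats-early d) ∧ all-checked k (suc d)

module _ (d : ℕ) .{{_ : NonZero d}} where

  -- Congruence instead of equality with the reduced remainder, so that the seeds `5 * k` and 5 may
  -- stay unreduced.
  Represents : ℕ → ℤ → Set
  Represents r z = + d ℤ.∣ z ℤ.- + r

  Earlier : ℕ → ℕ → Set
  Earlier j r = ∃ λ i → 1 ≤ i × i < j × Represents r (u i)

  represents-% : ∀ x → Represents (x ℕ.% d) (+ x)
  represents-% x = ℤ.divides (+ (x ℕ./ d)) (begin
    + x ℤ.- + (x ℕ.% d)
      ≡⟨ cong (λ z → + z ℤ.- + (x ℕ.% d)) (ℕ.m≡m%n+[m/n]*n x d) ⟩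
    + (x ℕ.% d + (x ℕ./ d) * d) ℤ.- + (x ℕ.% d)
      ≡⟨ cong (ℤ._- + (x ℕ.% d)) (trans (ℤ.pos-+ (x ℕ.% d) _) (cong (λ z → + (x ℕ.% d) ℤ.+ z) (ℤ.pos-* (x ℕ./ d) d))) ⟩
    + (x ℕ.% d) ℤ.+ + (x ℕ./ d) ℤ.* + d ℤ.- + (x ℕ.% d)
      ≡⟨ cancel (+ (x ℕ.% d)) (+ (x ℕ./ d) ℤ.* + d) ⟩
    + (x ℕ./ d) ℤ.* + d ∎)
    where
    open ≡-Reasoning
    cancel : ∀ r y → r ℤ.+ y ℤ.- r ≡ y
    cancel = ℤ-Ring.solve-∀

  represents-step : ∀ {j a r} → Represents a (+ 5 ℤ.* sgn j) → Represents r (u j) → Represents (step d a r) (u (suc j))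
  represents-step {j} {a} {r} a-rep r-rep = ∣-minus-trans (u (suc j)) (+ (3 * r + a)) (+ step d a r)
    (subst (+ d ℤ.∣_) expand (ℤ.∣m∣n⇒∣m+n (ℤ.∣n⇒∣m*n (+ 3) r-rep) a-rep))
    (represents-% (3 * r + a))
    where
    regroup : ∀ x r s a → + 3 ℤ.* (x ℤ.- r) ℤ.+ (s ℤ.- a) ≡ (+ 3 ℤ.* x ℤ.+ s) ℤ.- (+ 3 ℤ.* r ℤ.+ a)
    regroup = ℤ-Ring.solve-∀
    expand : + 3 ℤ.* (u j ℤ.- + r) ℤ.+ (+ 5 ℤ.* sgn j ℤ.- + a) ≡ u (suc j) ℤ.- + (3 * r + a)
    expand = trans (regroup (u j) (+ r) (+ 5 ℤ.* sgn j) (+ a)) (cong₂ ℤ._-_ (sym (u-step j))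
      (sym (trans (ℤ.pos-+ (3 * r) a) (cong (ℤ._+ + a) (ℤ.pos-* 3 r)))))

  member-sound : ∀ {j} r xs → T (member r xs) → All (Earlier j) xs → Earlier j r
  member-sound r (x ∷ xs) t (e ∷ es) with Equivalence.to (T-∨ {r ℕ.≡ᵇ x}) t
  ... | inj₁ r≡x = subst (Earlier _) (sym (ℕ.≡ᵇ⇒≡ r x r≡x)) e
  ... | inj₂ t′  = member-sound r xs t′ es

  later : ∀ {j r} → Earlier j r → Earlier (suc j) r
  later (i , 1≤i , i<j , rep) = i , 1≤i , ℕ.m<n⇒m<1+n i<j , rep

  repeats-sound : ∀ {n} k j a b r seen → 1 ≤ j → j + k ≤ suc n →
    Represents a (+ 5 ℤ.* sgn j) → Represents b (+ 5 ℤ.* sgn (suc j)) → Represents r (u j) → All (Earlier j) seen →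
    T (repeats k d a b r seen) → ¬ Discriminates n d
  repeats-sound {n} (suc k) j a b r seen 1≤j j+k≤n ra rb rr rs t disc with Equivalence.to (T-∨ {member r seen}) t
  ... | inj₁ m with i , 1≤i , i<j , ri ← member-sound r seen m rs =
    ℕ.<⇒≢ i<j (disc i j 1≤i (ℕ.≤-trans (ℕ.<⇒≤ i<j) j≤n) 1≤j j≤n (∣⇒∣ᵤ (∣-minus-trans (u i) (+ r) (u j) ri (∣-minus-sym (u j) (+ r) rr))))
    where
    j≤n = ℕ.≤-trans (ℕ.m≤m+n j k) (ℕ.≤-pred (subst (_≤ suc n) (ℕ.+-suc j k) j+k≤n))
  ... | inj₂ t′ = repeats-sound k (suc j) b a (step d a r) (r ∷ seen) (s≤s z≤n) (subst (_≤ suc n) (ℕ.+-suc j k) j+k≤n)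
    rb (subst (λ s → Represents a (+ 5 ℤ.* s)) (sym (ℤ.neg-involutive (sgn j))) ra)
    (represents-step {j} {a} {r} ra rr) ((j , 1≤j , ℕ.≤-refl , rr) ∷ All.map later rs) t′ disc

repeats-early-sound : ∀ d .{{_ : NonZero d}} → T (repeats-early d) → ¬ Discriminates (suc ⌊ d /2⌋) d
repeats-early-sound d@(suc k) = repeats-sound d (suc ⌊ d /2⌋) 1 (5 * k) 5 (2 ℕ.% d) [] ℕ.≤-refl ℕ.≤-refl
  (ℤ.divides (ℤ.- + 5) (trans (cong (λ z → ℤ.- + 5 ℤ.- z) (ℤ.pos-* 5 k)) (factor (+ k)))) ∣-self (represents-% d 2) []
  where
  factor : ∀ k → ℤ.- + 5 ℤ.- + 5 ℤ.* k ≡ ℤ.- + 5 ℤ.* (+ 1 ℤ.+ k)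
  factor = ℤ-Ring.solve-∀
  ∣-self : + d ℤ.∣ + 5 ℤ.- + 5
  ∣-self = ℤ.divides (+ 0) refl

small-factor-sound : ∀ k q d → T (small-factor k q d) → ¬ Prime d
small-factor-sound (suc k) q d t pd with Equivalence.to (T-∨ {(suc (suc q) ℕ.<ᵇ d) ∧ (d ℕ.% suc (suc q) ℕ.≡ᵇ 0)}) t
... | inj₂ t′ = small-factor-sound k (suc q) d t′ pd
... | inj₁ c with q<d , q∣d ← Equivalence.to (T-∧ {suc (suc q) ℕ.<ᵇ d}) c
  with prime⇒irreducible pd (ℕ.m%n≡0⇒n∣m d (suc (suc q)) (ℕ.≡ᵇ⇒≡ _ 0 q∣d))
... | inj₁ ()
... | inj₂ q≡d = ℕ.<⇒≢ (ℕ.<ᵇ⇒< (suc (suc q)) d q<d) q≡d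

all-checked-sound : ∀ k d x → T (all-checked k d) → d ≤ x → x < d + k → T (small-factor 40 0 x ∨ repeats-early x)
all-checked-sound zero    d x t d≤x x<d = contradiction (ℕ.<-≤-trans x<d (ℕ.≤-trans (ℕ.≤-reflexive (ℕ.+-identityʳ d)) d≤x)) (ℕ.<-irrefl refl)
all-checked-sound (suc k) d x t d≤x x<d+k with t₁ , t₂ ← Equivalence.to (T-∧ {small-factor 40 0 d ∨ repeats-early d}) t
  with ℕ.m≤n⇒m<n∨m≡n d≤x
... | inj₁ d<x  = all-checked-sound k (suc d) x t₂ d<x (subst (x <_) (ℕ.+-suc d k) x<d+k)
... | inj₂ refl = t₁

checked-prime-¬discriminates : ∀ k d → all-checked k d ≡ true → ∀ {p} → Prime p → d ≤ p → p < d + k → ¬ Discriminates (suc ⌊ p /2⌋) p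
checked-prime-¬discriminates k d checked {p} pp d≤p p<d+k
  with Equivalence.to (T-∨ {small-factor 40 0 p}) (all-checked-sound k d p (Equivalence.from T-≡ checked) d≤p p<d+k)
... | inj₁ s = contradiction pp (small-factor-sound 40 0 p s)
... | inj₂ r = repeats-early-sound p {{prime⇒nonZero pp}} r

-- The incidence bound takes over at 6562 = 9⁴ + 1, which leaves the 6555 moduli from 7 on to be
-- evaluated by `refl`.
small-prime-¬discriminates : ∀ {p} → Prime p → 7 ≤ p → p < 6562 → ¬ Discriminates (suc ⌊ p /2⌋) p
small-prime-¬discriminates = checked-prime-¬discriminates 6555 7 refl

-- Multiples of a prime p ≥ 7

double-cancel-≤ : ∀ {m n} → 2 * m ≤ 2 * n → m ≤ n
double-cancel-≤ {m} {n} = ℕ.*-cancelˡ-≤ 2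

halve-odd : ∀ h → ⌊ 1 + 2 * h /2⌋ ≡ h
halve-odd h = trans (cong ⌈_/2⌉ (cong (λ x → h + x) (ℕ.+-identityʳ h))) (sym (ℕ.n≡⌈n+n/2⌉ h))

quartic-bound : ∀ c {L p} .{{_ : NonZero p}} → p ≤ c * L → L * L * (L * L) ≤ p * p * p → p ≤ c * c * (c * c)
quartic-bound c {L} {p} p≤cL L⁴≤p³ = ℕ.*-cancelʳ-≤ p (c * c * (c * c)) (p * p * p) {{ℕ.m*n≢0 (p * p) p {{ℕ.m*n≢0 p p}}}} (begin
  p * (p * p * p)                       ≡⟨ regroup p ⟩
  (p * p) * (p * p)                     ≤⟨ ℕ.*-mono-≤ (ℕ.*-mono-≤ p≤cL p≤cL) (ℕ.*-mono-≤ p≤cL p≤cL) ⟩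
  (c * L * (c * L)) * (c * L * (c * L)) ≡⟨ collect c L ⟩
  c * c * (c * c) * (L * L * (L * L))   ≤⟨ ℕ.*-monoʳ-≤ (c * c * (c * c)) L⁴≤p³ ⟩
  c * c * (c * c) * (p * p * p)         ∎)
  where
  open ℕ.≤-Reasoning
  regroup : ∀ p → p * (p * p * p) ≡ (p * p) * (p * p)
  regroup = ℕ-Ring.solve-∀
  collect : ∀ c L → (c * L * (c * L)) * (c * L * (c * L)) ≡ c * c * (c * c) * (L * L * (L * L))
  collect = ℕ-Ring.solve-∀

large-prime-¬discriminates : ∀ {p} → Prime p → 6562 ≤ p → ∀ h → p ≡ 1 + 2 * h → ¬ Discriminates (suc h) p
-- The quotient L is the largest number with 4 L ≤ 2 + (h + 1). As the remainder is at most 3, h ≤ 4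
-- L, and so p ≤ 8 L + 1 ≤ 9 L once L ≥ 1.
large-prime-¬discriminates {p} pp 6562≤p h p≡1+2h disc with remainder 4 (h + 3)
... | r , zero , r<4 , eq = contradiction 6562≤p (ℕ.<⇒≱ (begin-strict
  p               ≡⟨ p≡1+2h ⟩
  1 + 2 * h       ≤⟨ ℕ.+-monoʳ-≤ 1 (ℕ.*-monoʳ-≤ 2 (ℕ.m≤m+n h 3)) ⟩
  1 + 2 * (h + 3) ≡⟨ cong (λ x → 1 + 2 * x) (trans eq (ℕ.+-identityʳ r)) ⟩
  1 + 2 * r       <⟨ ℕ.+-monoʳ-< 1 (ℕ.*-monoʳ-< 2 r<4) ⟩
  9               ≤⟨ from-yes (9 ℕ.≤? 6562) ⟩
  6562            ∎))
  where open ℕ.≤-Reasoning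
... | r , L@(suc _) , r<4 , eq = contradiction 6562≤p (ℕ.<⇒≱ (s≤s (quartic-bound 9 {L} {{prime⇒nonZero pp}} p≤9L
        (L⁴≤p³ pp (ℕ.≤-trans (from-yes (11 ℕ.≤? 6562)) 6562≤p) disc L 4L≤3+h))))
  where
  open ℕ.≤-Reasoning
  4L≤3+h : 4 * L ≤ 2 + suc h
  4L≤3+h = begin
    4 * L        ≤⟨ ℕ.m≤n+m (4 * L) r ⟩
    r + 4 * L    ≡⟨ eq ⟨
    h + 3        ≡⟨ ℕ.+-comm h 3 ⟩
    3 + h        ∎
  p≤9L : p ≤ 9 * L
  p≤9L = begin
    p            ≡⟨ p≡1+2h ⟩
    1 + 2 * h    ≤⟨ ℕ.+-monoʳ-≤ 1 (ℕ.*-monoʳ-≤ 2 (ℕ.+-cancelʳ-≤ 3 h (4 * L) (begin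
      h + 3        ≡⟨ eq ⟩
      r + 4 * L    ≤⟨ ℕ.+-monoˡ-≤ (4 * L) (ℕ.≤-pred r<4) ⟩
      3 + 4 * L    ≡⟨ ℕ.+-comm 3 (4 * L) ⟩
      4 * L + 3    ∎))) ⟩
    1 + 2 * (4 * L) ≤⟨ ℕ.+-monoˡ-≤ (2 * (4 * L)) (s≤s z≤n) ⟩
    L + 2 * (4 * L) ≡⟨ nine L ⟩
    9 * L        ∎
    where
    nine : ∀ L → L + 2 * (4 * L) ≡ 9 * L
    nine = ℕ-Ring.solve-∀

prime-¬discriminates : ∀ {p} → Prime p → 7 ≤ p → ∀ h → p ≡ 1 + 2 * h → ¬ Discriminates (suc h) p
prime-¬discriminates {p} pp 7≤p h p≡1+2h with p ℕ.<? 6562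
... | no  p≮6562 = large-prime-¬discriminates pp (ℕ.≮⇒≥ p≮6562) h p≡1+2h
... | yes p<6562 = subst (λ k → ¬ Discriminates (suc k) p) (trans (cong ⌊_/2⌋ p≡1+2h) (halve-odd h))
  (small-prime-¬discriminates pp 7≤p p<6562)

-- The p + 1 numbers ±3^s with s ≤ h cannot be distinct mod p = 2h + 1.
half-period : ∀ {p} → Prime p → 3 < p → ∀ h → p ≡ 1 + 2 * h → ∃ λ t → 1 ≤ t × t ≤ h × p ∣ rep 8 t
half-period {p} pp 3<p h p≡1+2h = conclude (Fin.pigeonhole p<2+2h (residue p ∘ signed ∘ split))
  where
  instance
    p≢0 : NonZero p
    p≢0 = prime⇒nonZero pp
  split : Fin (suc h + suc h) → Fin (suc h) ⊎ Fin (suc h)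
  split = Fin.splitAt (suc h)
  split-injective : ∀ {i j} → split i ≡ split j → i ≡ j
  split-injective {i} {j} e = trans (sym (Fin.join-splitAt (suc h) (suc h) i))
    (trans (cong (Fin.join (suc h) (suc h)) e) (Fin.join-splitAt (suc h) (suc h) j))
  signed : Fin (suc h) ⊎ Fin (suc h) → ℤ
  signed (inj₁ s) = + (3 ^ toℕ s)
  signed (inj₂ s) = ℤ.- + (3 ^ toℕ s)
  exponent : Fin (suc h) ⊎ Fin (suc h) → Fin (suc h)
  exponent (inj₁ s) = s
  exponent (inj₂ s) = s
  p<2+2h : p < suc h + suc h
  p<2+2h = ℕ.≤-reflexive (trans (cong suc p≡1+2h) (double h))
    where
    double : ∀ h → 2 + 2 * h ≡ suc h + suc h
    double = ℕ-Ring.solve-∀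
  9^≡3^*3^ : ∀ s → 9^ s ≡ + (3 ^ s) ℤ.* + (3 ^ s)
  9^≡3^*3^ s = trans (cong +_ (trans (ℕ.^-*-assoc 3 2 s) (trans (cong (3 ^_) (cong (λ x → s + x) (ℕ.+-identityʳ s))) (ℕ.^-distribˡ-+-* 3 s s)))) (ℤ.pos-* (3 ^ s) (3 ^ s))
  square : ∀ x → signed x ℤ.* signed x ≡ 9^ (toℕ (exponent x))
  square (inj₁ s) = sym (9^≡3^*3^ (toℕ s))
  square (inj₂ s) = trans (neg-square (+ (3 ^ toℕ s))) (sym (9^≡3^*3^ (toℕ s)))
    where
    neg-square : ∀ x → ℤ.- x ℤ.* ℤ.- x ≡ x ℤ.* x
    neg-square = ℤ-Ring.solve-∀
  -- Squaring removes the signs and turns powers of 3 into powers of 9, so the collision yields 9^a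
  -- ≡ 9^b with a, b ≤ h. No appeal to Fermat's theorem is made.
  squares : ∀ x y → + p ℤ.∣ signed x ℤ.- signed y → + p ℤ.∣ 9^ (toℕ (exponent x)) ℤ.- 9^ (toℕ (exponent y))
  squares x y d = subst (+ p ℤ.∣_) (trans (factor (signed x) (signed y)) (cong₂ ℤ._-_ (square x) (square y))) (ℤ.∣m⇒∣m*n (signed x ℤ.+ signed y) d)
    where
    factor : ∀ a b → (a ℤ.- b) ℤ.* (a ℤ.+ b) ≡ a ℤ.* a ℤ.- b ℤ.* b
    factor = ℤ-Ring.solve-∀
  p∤2*3^ : ∀ s → ¬ p ∣ 2 * 3 ^ s
  p∤2*3^ s d with euclidsLemma 2 (3 ^ s) pp d
  ... | inj₁ e = contradiction e (ℕ.>⇒∤ (ℕ.<-trans (from-yes (2 ℕ.<? 3)) 3<p))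
  ... | inj₂ e = contradiction e (prime∤power pp prime[3] (ℕ.>⇒≢ 3<p) s)
  -- Equal exponents with opposite signs would make p divide 2 · 3^s.
  exponents-differ : ∀ x y → x ≢ y → + p ℤ.∣ signed x ℤ.- signed y → exponent x ≢ exponent y
  exponents-differ (inj₁ s) (inj₁ .s) x≢y d refl = x≢y refl
  exponents-differ (inj₂ s) (inj₂ .s) x≢y d refl = x≢y refl
  exponents-differ (inj₁ s) (inj₂ .s) x≢y d refl = p∤2*3^ (toℕ s)
    (∣⇒∣ᵤ (subst (+ p ℤ.∣_) (trans (double (+ (3 ^ toℕ s))) (sym (ℤ.pos-* 2 (3 ^ toℕ s)))) d))
    where
    double : ∀ x → x ℤ.- ℤ.- x ≡ + 2 ℤ.* x
    double = ℤ-Ring.solve-∀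
  exponents-differ (inj₂ s) (inj₁ .s) x≢y d refl = p∤2*3^ (toℕ s)
    (∣⇒∣ᵤ (subst (+ p ℤ.∣_) (trans (double (+ (3 ^ toℕ s))) (sym (ℤ.pos-* 2 (3 ^ toℕ s)))) (ℤ.∣m⇒∣-m d)))
    where
    double : ∀ x → ℤ.- (ℤ.- x ℤ.- x) ≡ + 2 ℤ.* x
    double = ℤ-Ring.solve-∀
  period : ∀ a b → a < suc h → b < suc h → a ≢ b → + p ℤ.∣ 9^ a ℤ.- 9^ b → ∃ λ t → 1 ≤ t × t ≤ h × p ∣ rep 8 t
  period a b a≤h b≤h a≢b d with ℕ.≤-total a b
  ... | inj₁ a≤b with t , refl ← ℕ.m≤n⇒∃[o]m+o≡n a≤b =
    t , ℕ.n≢0⇒n>0 (λ { refl → a≢b (sym (ℕ.+-identityʳ a)) }) , ℕ.≤-trans (ℕ.m≤n+m t a) (ℕ.≤-pred b≤h) ,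
    9^-collision pp 3<p a t (∣-minus-sym (9^ a) (9^ (a + t)) d)
  ... | inj₂ b≤a with t , refl ← ℕ.m≤n⇒∃[o]m+o≡n b≤a =
    t , ℕ.n≢0⇒n>0 (λ { refl → a≢b (ℕ.+-identityʳ b) }) , ℕ.≤-trans (ℕ.m≤n+m t b) (ℕ.≤-pred a≤h) ,
    9^-collision pp 3<p b t d
  resolve : ∀ x y → x ≢ y → + p ℤ.∣ signed x ℤ.- signed y → ∃ λ t → 1 ≤ t × t ≤ h × p ∣ rep 8 t
  resolve x y x≢y d = period (toℕ (exponent x)) (toℕ (exponent y)) (Fin.toℕ<n (exponent x)) (Fin.toℕ<n (exponent y))
    (exponents-differ x y x≢y d ∘ Fin.toℕ-injective) (squares x y d)
  conclude : (∃₂ λ i j → i Fin.< j × residue p (signed (split i)) ≡ residue p (signed (split j))) → ∃ λ t → 1 ≤ t × t ≤ h × p ∣ rep 8 t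
  conclude (i , j , i<j , eq) = resolve (split i) (split j) (Fin.<⇒≢ i<j ∘ split-injective)
    (residue-≡ p (signed (split i)) (signed (split j)) eq)

-- Starting at index 1, where 2 · 3^1 = 6, the last of the q + 1 terms has index 1 + 2 t q ≤ 1 + d q
-- / 2.
short-period-¬discriminates : ∀ {n} d q t .{{_ : NonZero q}} .{{_ : NonZero t}} → 4 * t ≤ d → d ∣ 6 * rep 8 t →
  d * q + 3 ≤ 2 * n → ¬ Discriminates n (d * q)
short-period-¬discriminates {n} d q t 4t≤d d∣ m+3≤2n = period-¬discriminates d q 1 t ℕ.≤-refl (double-cancel-≤ (begin
  2 * (1 + 2 * (q * t))  ≡⟨ expand q t ⟩
  4 * t * q + 2          ≤⟨ ℕ.+-mono-≤ (ℕ.*-monoˡ-≤ q 4t≤d) (from-yes (2 ℕ.≤? 3)) ⟩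
  d * q + 3              ≤⟨ m+3≤2n ⟩
  2 * n                  ∎)) d∣
  where
  open ℕ.≤-Reasoning
  expand : ∀ q t → 2 * (1 + 2 * (q * t)) ≡ 4 * t * q + 2
  expand = ℕ-Ring.solve-∀

-- A collision mod p doubles the population of a class, which compensates for a period exceeding p / 2.
lift-discriminates : ∀ {p n} h r t .{{_ : NonZero t}} → p ∣ rep 8 t → t ≤ h → h < 2 * t → p ≡ 1 + 2 * h →
  p * (r + suc r) + 3 ≤ 2 * n → Discriminates n (p * (r + suc r)) → Discriminates (suc h) p
lift-discriminates {p} {n} h r t p∣rep t≤h h<2t p≡1+2h m+3≤2n disc i j 1≤i i≤h+1 1≤j j≤h+1 i~j with i ℕ.≟ j
... | yes i≡j = i≡j
-- The translates of i and of j by 2 t s with s ≤ r are 2 r + 2 terms in one class mod p, which has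
-- only 2 r + 1 subclasses. Writing the odd cofactor as `r + suc r` makes its successor unfold to
-- `suc r + suc r`, as `splitAt` needs.
... | no  i≢j = contradiction disc (crowded-class p (r + suc r) {{ℕ.>-nonZero (ℕ.≤-trans (s≤s z≤n) (ℕ.m≤n+m (suc r) r))}}
    (u i) (index ∘ Fin.splitAt (suc r)) (range ∘ Fin.splitAt (suc r))
    (λ {s} {s′} e → trans (sym (Fin.join-splitAt (suc r) (suc r) s)) (trans (cong (Fin.join (suc r) (suc r))
      (index-injective (Fin.splitAt (suc r) s) (Fin.splitAt (suc r) s′) e)) (Fin.join-splitAt (suc r) (suc r) s′)))
    (same-class ∘ Fin.splitAt (suc r)))
  where
  index : Fin (suc r) ⊎ Fin (suc r) → ℕ
  index (inj₁ s) = i + 2 * (toℕ s * t)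
  index (inj₂ s) = j + 2 * (toℕ s * t)

  bound : ∀ k (s : Fin (suc r)) → k ≤ suc h → k + 2 * (toℕ s * t) ≤ n
  bound k s k≤h+1 = double-cancel-≤ (begin
    2 * (k + 2 * (toℕ s * t))    ≤⟨ ℕ.*-monoʳ-≤ 2 (ℕ.+-mono-≤ k≤h+1 (ℕ.*-monoʳ-≤ 2 (ℕ.*-mono-≤ (ℕ.≤-pred (Fin.toℕ<n s)) t≤h))) ⟩
    2 * (suc h + 2 * (r * h))    ≤⟨ ℕ.m≤m+n _ (2 + 2 * r) ⟩
    2 * (suc h + 2 * (r * h)) + (2 + 2 * r) ≡⟨ expand r h ⟩
    (1 + 2 * h) * (r + suc r) + 3 ≡⟨ cong (λ p → p * (r + suc r) + 3) p≡1+2h ⟨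
    p * (r + suc r) + 3          ≤⟨ m+3≤2n ⟩
    2 * n                        ∎)
    where
    open ℕ.≤-Reasoning
    expand : ∀ r h → 2 * (suc h + 2 * (r * h)) + (2 + 2 * r) ≡ (1 + 2 * h) * (r + suc r) + 3
    expand = ℕ-Ring.solve-∀

  range : ∀ x → 1 ≤ index x × index x ≤ n
  range (inj₁ s) = ℕ.≤-trans 1≤i (ℕ.m≤m+n i _) , bound i s i≤h+1
  range (inj₂ s) = ℕ.≤-trans 1≤j (ℕ.m≤m+n j _) , bound j s j≤h+1

  -- Since h < 2 t, the indices 1, ..., h + 1 fit into one period of length 2 t, so translates of i
  -- and j can meet only if i = j.
  no-wrap : ∀ {k l} s s′ → k ≤ suc h → 1 ≤ l → k + 2 * (s * t) ≡ l + 2 * (s′ * t) → s′ ≤ s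
  no-wrap {k} {l} s s′ k≤h+1 1≤l eq = ℕ.≮⇒≥ λ s<s′ → ℕ.<⇒≢ (begin-strict
    k + 2 * (s * t)           ≤⟨ ℕ.+-monoˡ-≤ (2 * (s * t)) k≤h+1 ⟩
    suc h + 2 * (s * t)       <⟨ ℕ.+-monoˡ-< (2 * (s * t)) (s≤s h<2t) ⟩
    suc (2 * t) + 2 * (s * t) ≡⟨ expand s t ⟩
    1 + 2 * (suc s * t)       ≤⟨ ℕ.+-mono-≤ 1≤l (ℕ.*-monoʳ-≤ 2 (ℕ.*-monoˡ-≤ t s<s′)) ⟩
    l + 2 * (s′ * t)          ∎) eq
    where
    open ℕ.≤-Reasoning
    expand : ∀ s t → suc (2 * t) + 2 * (s * t) ≡ 1 + 2 * (suc s * t)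
    expand = ℕ-Ring.solve-∀

  steps-injective : ∀ k (s s′ : Fin (suc r)) → k + 2 * (toℕ s * t) ≡ k + 2 * (toℕ s′ * t) → s ≡ s′
  steps-injective k s s′ eq = Fin.toℕ-injective (ℕ.*-cancelʳ-≡ (toℕ s) (toℕ s′) t
    (ℕ.*-cancelˡ-≡ (toℕ s * t) (toℕ s′ * t) 2 (ℕ.+-cancelˡ-≡ k _ _ eq)))

  steps-disjoint : ∀ s s′ → i + 2 * (s * t) ≢ j + 2 * (s′ * t)
  steps-disjoint s s′ eq with ℕ.≤-antisym (no-wrap s′ s j≤h+1 1≤i (sym eq)) (no-wrap s s′ i≤h+1 1≤j eq)
  ... | refl = i≢j (ℕ.+-cancelʳ-≡ (2 * (s * t)) i j eq)

  index-injective : ∀ x y → index x ≡ index y → x ≡ y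
  index-injective (inj₁ s) (inj₁ s′) eq = cong inj₁ (steps-injective i s s′ eq)
  index-injective (inj₂ s) (inj₂ s′) eq = cong inj₂ (steps-injective j s s′ eq)
  index-injective (inj₁ s) (inj₂ s′) eq = contradiction eq (steps-disjoint (toℕ s) (toℕ s′))
  index-injective (inj₂ s) (inj₁ s′) eq = contradiction (sym eq) (steps-disjoint (toℕ s′) (toℕ s))

  periodic : ∀ k s → + p ℤ.∣ u (k + 2 * (s * t)) ℤ.- u k
  periodic k s = u-periodic k (s * t) (∣-rep-* (2 * 3 ^ k) t s (ℕ.∣n⇒∣m*n (2 * 3 ^ k) p∣rep))

  same-class : ∀ x → + p ℤ.∣ u (index x) ℤ.- u i
  same-class (inj₁ s) = periodic i (toℕ s)
  same-class (inj₂ s) = ∣-minus-trans (u (index (inj₂ s))) (u j) (u i) (periodic j (toℕ s)) (∣-minus-sym (u i) (u j) (∣ᵤ⇒∣ i~j))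

odd-prime : ∀ {p} → Prime p → p ≢ 2 → ∃ λ h → p ≡ 1 + 2 * h
odd-prime {p} pp p≢2 with remainder 2 p
... | 1 , h , _ , p≡1+2h = h , p≡1+2h
... | suc (suc _) , _ , s≤s (s≤s ()) , _
... | 0 , h , _ , p≡2h with prime⇒irreducible pp (divides h (trans p≡2h (ℕ.*-comm 2 h)))
...   | inj₂ 2≡p = contradiction (sym 2≡p) p≢2

-- Equal-parity differences are always even, so a period mod p is one mod 2 p too; relative to 2 p
-- it is short, because 4 t ≤ 4 h < 2 p.
even-multiple-¬discriminates : ∀ {p n} h t .{{_ : NonZero t}} → t ≤ h → p ∣ rep 8 t → p ≡ 1 + 2 * h →
  ∀ r .{{_ : NonZero r}} → p * (2 * r) + 3 ≤ 2 * n → ¬ Discriminates n (p * (2 * r))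
even-multiple-¬discriminates {p} {n} h t t≤h p∣rep p≡1+2h r m+3≤2n disc =
  short-period-¬discriminates (2 * p) r t 4t≤2p
    (subst (2 * p ∣_) (sym (ℕ.*-assoc 2 3 (rep 8 t))) (ℕ.*-monoʳ-∣ 2 (ℕ.∣n⇒∣m*n 3 p∣rep)))
    (subst (λ m → m + 3 ≤ 2 * n) (swap p r) m+3≤2n) (subst (Discriminates n) (swap p r) disc)
  where
  open ℕ.≤-Reasoning
  swap : ∀ p r → p * (2 * r) ≡ 2 * p * r
  swap = ℕ-Ring.solve-∀
  4t≤2p : 4 * t ≤ 2 * p
  4t≤2p = begin
    4 * t           ≡⟨ ℕ.*-assoc 2 2 t ⟩
    2 * (2 * t)     ≤⟨ ℕ.*-monoʳ-≤ 2 (ℕ.*-monoʳ-≤ 2 t≤h) ⟩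
    2 * (2 * h)     ≤⟨ ℕ.*-monoʳ-≤ 2 (ℕ.n≤1+n (2 * h)) ⟩
    2 * (1 + 2 * h) ≡⟨ cong (2 *_) p≡1+2h ⟨
    2 * p           ∎

-- If 2 t ≤ h, the period alone is short enough. Otherwise a collision mod p among the first h + 1
-- terms is needed, and only this case uses the incidence bound or the computation.
odd-multiple-¬discriminates : ∀ {p n} → Prime p → 7 ≤ p → ∀ h t .{{_ : NonZero t}} → t ≤ h → p ∣ rep 8 t → p ≡ 1 + 2 * h →
  ∀ r → p * (r + suc r) + 3 ≤ 2 * n → ¬ Discriminates n (p * (r + suc r))
odd-multiple-¬discriminates {p} {n} pp 7≤p h t t≤h p∣rep p≡1+2h r m+3≤2n disc with 2 * t ℕ.≤? h
... | no 2t≰h = prime-¬discriminates pp 7≤p h p≡1+2h (lift-discriminates h r t p∣rep t≤h (ℕ.≰⇒> 2t≰h) p≡1+2h m+3≤2n disc)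
... | yes 2t≤h = short-period-¬discriminates p (r + suc r) t {{ℕ.>-nonZero (ℕ.≤-trans (s≤s z≤n) (ℕ.m≤n+m (suc r) r))}}
  4t≤p (ℕ.∣n⇒∣m*n 6 p∣rep) m+3≤2n disc
  where
  open ℕ.≤-Reasoning
  4t≤p : 4 * t ≤ p
  4t≤p = begin
    4 * t       ≡⟨ ℕ.*-assoc 2 2 t ⟩
    2 * (2 * t) ≤⟨ ℕ.*-monoʳ-≤ 2 2t≤h ⟩
    2 * h       ≤⟨ ℕ.n≤1+n (2 * h) ⟩
    1 + 2 * h   ≡⟨ p≡1+2h ⟨
    p           ∎

prime-multiple-¬discriminates : ∀ {p n} → Prime p → 7 ≤ p → ∀ q .{{_ : NonZero q}} → p * q + 3 ≤ 2 * n → ¬ Discriminates n (p * q)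
prime-multiple-¬discriminates {p} {n} pp 7≤p q m+3≤2n =
  with-half (odd-prime pp (ℕ.>⇒≢ (ℕ.<-≤-trans (from-yes (2 ℕ.<? 7)) 7≤p)))
  where
  odd : ∀ r → 1 + 2 * r ≡ r + suc r
  odd = ℕ-Ring.solve-∀
  by-parity : ∀ h t → 1 ≤ t → t ≤ h → p ∣ rep 8 t → p ≡ 1 + 2 * h → ∀ q .{{_ : NonZero q}} → p * q + 3 ≤ 2 * n →
    (∃₂ λ r d → r < 2 × q ≡ r + 2 * d) → ¬ Discriminates n (p * q)
  by-parity h t 1≤t t≤h p∣rep p≡1+2h q m+3≤2n (0 , zero , _ , refl) = contradiction refl (ℕ.≢-nonZero⁻¹ 0)
  by-parity h t 1≤t t≤h p∣rep p≡1+2h q m+3≤2n (0 , r@(suc _) , _ , refl) =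
    even-multiple-¬discriminates h t {{ℕ.>-nonZero 1≤t}} t≤h p∣rep p≡1+2h r m+3≤2n
  by-parity h t 1≤t t≤h p∣rep p≡1+2h q m+3≤2n (1 , r , _ , refl) =
    odd-multiple-¬discriminates pp 7≤p h t {{ℕ.>-nonZero 1≤t}} t≤h p∣rep p≡1+2h r
      (subst (λ m → p * m + 3 ≤ 2 * n) (odd r) m+3≤2n) ∘ subst (λ m → Discriminates n (p * m)) (odd r)
  by-parity h t 1≤t t≤h p∣rep p≡1+2h q m+3≤2n (suc (suc _) , _ , s≤s (s≤s ()) , _)
  with-period : ∀ h → p ≡ 1 + 2 * h → (∃ λ t → 1 ≤ t × t ≤ h × p ∣ rep 8 t) → ¬ Discriminates n (p * q)
  with-period h p≡1+2h (t , 1≤t , t≤h , p∣rep) = by-parity h t 1≤t t≤h p∣rep p≡1+2h q m+3≤2n (remainder 2 q)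
  with-half : (∃ λ h → p ≡ 1 + 2 * h) → ¬ Discriminates n (p * q)
  with-half (h , p≡1+2h) = with-period h p≡1+2h (half-period pp (ℕ.<-≤-trans (from-yes (3 ℕ.<? 7)) 7≤p) h p≡1+2h)

-- The remaining moduli

power-or-other-prime : ∀ {p} m .{{_ : NonZero m}} → Prime p → (∃ λ k → m ≡ p ^ k) ⊎ (∃ λ q → Prime q × q ≢ p × q ∣ m)
power-or-other-prime {p} m pp = subst Goal (sym isFactorisation) (search factors factorsPrime)
  where
  open PrimeFactorisation (factorise m)
  Goal : ℕ → Set
  Goal m = (∃ λ k → m ≡ p ^ k) ⊎ (∃ λ q → Prime q × q ≢ p × q ∣ m)
  search : ∀ qs → All Prime qs → Goal (product qs)
  search []       []         = inj₁ (0 , refl)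
  search (q ∷ qs) (pq ∷ pqs) with q ℕ.≟ p
  ... | no  q≢p  = inj₂ (q , pq , q≢p , ℕ.m∣m*n (product qs))
  ... | yes refl with search qs pqs
  ...   | inj₁ (k , eq) = inj₁ (suc k , cong (q *_) eq)
  ...   | inj₂ (r , pr , r≢q , r∣) = inj₂ (r , pr , r≢q , ℕ.∣n⇒∣m*n q r∣)

data PrimeView : ℕ → Set where
  two   : PrimeView 2
  three : PrimeView 3
  five  : PrimeView 5
  large : ∀ {p} → 7 ≤ p → PrimeView p

primeView : ∀ p → Prime p → PrimeView p
primeView 0 pp = contradiction pp (from-no (prime? 0))
primeView 1 pp = contradiction pp (from-no (prime? 1))
primeView 2 pp = two
primeView 3 pp = three
primeView 4 pp = contradiction pp (from-no (prime? 4))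
primeView 5 pp = five
primeView 6 pp = contradiction pp (from-no (prime? 6))
primeView (suc (suc (suc (suc (suc (suc (suc p))))))) pp = large (ℕ.m≤m+n 7 p)

module _ {n : ℕ} where

  Excluded : ℕ → Set
  Excluded m = m + 3 ≤ 2 * n → ¬ Discriminates n m

  private
    excluded-≡ : ∀ {m m′} → m ≡ m′ → Excluded m → Excluded m′
    excluded-≡ refl e = e

  prime-multiple-excluded : ∀ {p} → Prime p → 7 ≤ p → ∀ q .{{_ : NonZero q}} → Excluded (q * p)
  prime-multiple-excluded {p} pp 7≤p q = excluded-≡ (ℕ.*-comm p q) (prime-multiple-¬discriminates pp 7≤p q)

  6-excluded : ∀ q .{{_ : NonZero q}} → Excluded (q * 2 * 3)
  6-excluded q = excluded-≡ (regroup q) (short-period-¬discriminates 6 q 1 (from-yes (4 ℕ.≤? 6)) (divides 1 refl))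
    where
    regroup : ∀ q → 6 * q ≡ q * 2 * 3
    regroup = ℕ-Ring.solve-∀

  -- The period 4 comes from 6 * rep 8 2 = 60, which is divisible by 10 and by 15.
  10-excluded : ∀ q .{{_ : NonZero q}} → Excluded (q * 2 * 5)
  10-excluded q = excluded-≡ (regroup q) (short-period-¬discriminates 10 q 2 (from-yes (8 ℕ.≤? 10)) (divides 6 refl))
    where
    regroup : ∀ q → 10 * q ≡ q * 2 * 5
    regroup = ℕ-Ring.solve-∀

  15-excluded : ∀ q .{{_ : NonZero q}} → Excluded (15 * q)
  15-excluded q = short-period-¬discriminates 15 q 2 (from-yes (8 ℕ.≤? 15)) (divides 4 refl)

  -- Modulo 9 the sequence has period 2 only from its second term on.
  9-excluded : ∀ q .{{_ : NonZero q}} → Excluded (q * 3 * 3)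
  9-excluded q@(suc k) m+3≤2n = subst (λ m → ¬ Discriminates n m) (regroup q)
    (period-¬discriminates 9 q 2 1 (s≤s z≤n) (double-cancel-≤ (begin
      2 * (2 + 2 * (q * 1))            ≤⟨ ℕ.m≤m+n _ (4 + 5 * k) ⟩
      2 * (2 + 2 * (q * 1)) + (4 + 5 * k) ≡⟨ expand k ⟩
      q * 3 * 3 + 3                    ≤⟨ m+3≤2n ⟩
      2 * n                            ∎)) (divides 2 refl))
    where
    open ℕ.≤-Reasoning
    regroup : ∀ q → 9 * q ≡ q * 3 * 3
    regroup = ℕ-Ring.solve-∀
    expand : ∀ k → 2 * (2 + 2 * (suc k * 1)) + (4 + 5 * k) ≡ suc k * 3 * 3 + 3
    expand = ℕ-Ring.solve-∀

  -- The period 2 exceeds 3 / 2, so the short-period lemma does not apply; but 6 ≤ 2 n already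
  -- admits u 3 = 8, congruent to u 1 = 2.
  3-excluded : Excluded 3
  3-excluded 6≤2n = period-¬discriminates 3 1 1 1 ℕ.≤-refl (double-cancel-≤ 6≤2n) (divides 2 refl)

  multiple-of-3-excluded : ∀ k .{{_ : NonZero k}} → Excluded (k * 3)
  multiple-of-3-excluded k with power-or-other-prime k prime[2]
  ... | inj₁ (zero  , refl) = 3-excluded
  ... | inj₁ (suc c , refl) = excluded-≡ (cong (_* 3) (ℕ.*-comm (2 ^ c) 2)) (6-excluded (2 ^ c) {{ℕ.m^n≢0 2 c}})
  ... | inj₂ (r , pr , r≢2 , divides q refl) with primeView r pr
  ...   | two       = contradiction refl r≢2
  ...   | three     = 9-excluded q {{ℕ.m*n≢0⇒m≢0 q}}
  ...   | five      = excluded-≡ (regroup q) (15-excluded q {{ℕ.m*n≢0⇒m≢0 q}})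
    where
    regroup : ∀ q → 15 * q ≡ q * 5 * 3
    regroup = ℕ-Ring.solve-∀
  ...   | large 7≤r = excluded-≡ (swap q r) (prime-multiple-excluded pr 7≤r (q * 3) {{ℕ.m*n≢0 q 3 {{ℕ.m*n≢0⇒m≢0 q}}}})
    where
    swap : ∀ q r → q * 3 * r ≡ q * r * 3
    swap = ℕ-Ring.solve-∀

  multiple-of-5-excluded : ∀ k .{{_ : NonZero k}} → (∃ λ c → k * 5 ≡ 5 ^ c) ⊎ Excluded (k * 5)
  multiple-of-5-excluded k with power-or-other-prime k prime[5]
  ... | inj₁ (c , refl) = inj₁ (suc c , ℕ.*-comm (5 ^ c) 5)
  ... | inj₂ (r , pr , r≢5 , divides q refl) with primeView r pr
  ...   | two       = inj₂ (10-excluded q {{ℕ.m*n≢0⇒m≢0 q}})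
  ...   | three     = inj₂ (excluded-≡ (regroup q) (15-excluded q {{ℕ.m*n≢0⇒m≢0 q}}))
    where
    regroup : ∀ q → 15 * q ≡ q * 3 * 5
    regroup = ℕ-Ring.solve-∀
  ...   | five      = contradiction refl r≢5
  ...   | large 7≤r = inj₂ (excluded-≡ (swap q r) (prime-multiple-excluded pr 7≤r (q * 5) {{ℕ.m*n≢0 q 5 {{ℕ.m*n≢0⇒m≢0 q}}}}))
    where
    swap : ∀ q r → q * 5 * r ≡ q * r * 5
    swap = ℕ-Ring.solve-∀

  powers-or-excluded : ∀ m .{{_ : NonZero m}} → (∃ λ c → m ≡ 2 ^ c) ⊎ (∃ λ c → m ≡ 5 ^ c) ⊎ Excluded m
  powers-or-excluded m with power-or-other-prime m prime[2]
  ... | inj₁ power = inj₁ power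
  ... | inj₂ (r , pr , r≢2 , divides q refl) with primeView r pr
  ...   | two       = contradiction refl r≢2
  ...   | three     = inj₂ (inj₂ (multiple-of-3-excluded q {{ℕ.m*n≢0⇒m≢0 q}}))
  ...   | five      = inj₂ (multiple-of-5-excluded q {{ℕ.m*n≢0⇒m≢0 q}})
  ...   | large 7≤r = inj₂ (inj₂ (prime-multiple-excluded pr 7≤r q {{ℕ.m*n≢0⇒m≢0 q}}))

-- Powers below the minimum, and the conclusion

discriminates⇒≤ : ∀ {n} m .{{_ : NonZero m}} → Discriminates n m → n ≤ m
discriminates⇒≤ {n} m disc = ℕ.≮⇒≥ λ m<n → contradiction (subst (Discriminates n) (sym (ℕ.*-identityˡ m)) disc)
  (crowded-class 1 m (+ 0) (suc ∘ toℕ) (λ s → s≤s z≤n , ℕ.≤-trans (Fin.toℕ<n s) m<n)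
    (Fin.toℕ-injective ∘ ℕ.suc-injective) (λ s → ∣ᵤ⇒∣ (ℕ.1∣ _)))

-- For c ≥ 1 the period 4 mod 5 puts the 5^(c - 1) + 1 terms at 1 + 4 s into one class mod 5; the
-- last index 1 + 4 · 5^(c - 1) is at most n exactly by the first inequality.
5^-¬discriminates : ∀ {n} c → 4 * 5 ^ c < 5 * n → 5 ^ c + 3 ≤ 2 * n → ¬ Discriminates n (5 ^ c)
-- Modulus 1 does discriminate a single term although 4 < 5, so this case rests on the second
-- inequality, which gives n ≥ 2.
5^-¬discriminates {n} zero _ 4≤2n disc = contradiction (double-cancel-≤ {2} {n} 4≤2n) (ℕ.<⇒≱ (s≤s (discriminates⇒≤ 1 disc)))
5^-¬discriminates {n} (suc c) 4*5^c<5n _ = period-¬discriminates 5 (5 ^ c) 1 2 {{ℕ.m^n≢0 5 c}} ℕ.≤-refl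
  (ℕ.*-cancelˡ-< 5 _ _ (subst (_< 5 * n) (regroup (5 ^ c)) 4*5^c<5n)) (divides 12 refl)
  where
  regroup : ∀ x → 4 * (5 * x) ≡ 5 * (2 * (x * 2))
  regroup = ℕ-Ring.solve-∀

theorem1 : ∀ (n : ℕ) → 1 ≤ n → ∀ (f : ℕ) → IsCeilLog5-5n/4 n f →
    IsDiscriminator n ((2 ^ ⌈log₂ n ⌉) ⊓ (5 ^ f))
theorem1 n 1≤n f (5n≤4*5^f , f-least) =
  ℕ.⊓-glb (ℕ.m^n>0 2 e) (ℕ.m^n>0 5 f) , discriminates , least
  where
  e = ⌈log₂ n ⌉

  5^f-discriminates : ∀ f → 5 * n ≤ 4 * 5 ^ f → Discriminates n (5 ^ f)
  5^f-discriminates zero    5n≤4 = contradiction (ℕ.≤-trans (ℕ.*-monoʳ-≤ 5 1≤n) 5n≤4) (from-no (5 ℕ.≤? 4))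
  5^f-discriminates (suc f) 5n≤4*5^f = 5^-discriminates f (ℕ.*-cancelˡ-≤ 5 (subst (5 * n ≤_) (swap (5 ^ f)) 5n≤4*5^f))
    where
    swap : ∀ x → 4 * (5 * x) ≡ 5 * (4 * x)
    swap = ℕ-Ring.solve-∀

  discriminates : Discriminates n (2 ^ e ⊓ 5 ^ f)
  discriminates with ℕ.⊓-sel (2 ^ e) (5 ^ f)
  ... | inj₁ eq = subst (Discriminates n) (sym eq) (2^-discriminates e (n≤2^⌈log₂n⌉ n))
  ... | inj₂ eq = subst (Discriminates n) (sym eq) (5^f-discriminates f 5n≤4*5^f)

  2^<n : ∀ c → c < e → 2 ^ c < n
  2^<n c c<e = ℕ.≰⇒> λ n≤2^c → ℕ.<⇒≱ c<e (subst (e ≤_) (⌈log₂2^n⌉≡n c) (⌈log₂⌉-mono-≤ n≤2^c))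

  -- Minimality of the exponent gives 2^(d - 1) + 1 ≤ n, and doubling this gives 2^d + 2 ≤ 2 n.
  below-2^ : ∀ k d → (∀ c → c < d → 2 ^ c < n) → 1 ≤ k → k < 2 ^ d → k + 3 ≤ 2 * n
  below-2^ k zero    _    1≤k k<1   = contradiction (ℕ.<-≤-trans k<1 1≤k) (ℕ.<-irrefl refl)
  below-2^ k (suc d) 2^<n 1≤k k<2^d = begin
    k + 3              ≡⟨ ℕ.+-suc k 2 ⟩
    suc k + 2          ≤⟨ ℕ.+-monoˡ-≤ 2 k<2^d ⟩
    2 * 2 ^ d + 2      ≡⟨ collect (2 ^ d) ⟩
    2 * suc (2 ^ d)    ≤⟨ ℕ.*-monoʳ-≤ 2 (2^<n d ℕ.≤-refl) ⟩
    2 * n              ∎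
    where
    open ℕ.≤-Reasoning
    collect : ∀ x → 2 * x + 2 ≡ 2 * suc x
    collect = ℕ-Ring.solve-∀

  ^-reflects-< : ∀ b {c d} .{{_ : NonZero b}} → b ^ c < b ^ d → c < d
  ^-reflects-< b {c} {d} b^c<b^d = ℕ.≰⇒> λ d≤c → ℕ.<⇒≱ b^c<b^d (ℕ.^-monoʳ-≤ b d≤c)

  excluded : ∀ k → k < 2 ^ e → k < 5 ^ f → k + 3 ≤ 2 * n →
    (∃ λ c → k ≡ 2 ^ c) ⊎ (∃ λ c → k ≡ 5 ^ c) ⊎ Excluded {n} k → ¬ Discriminates n k
  excluded k k<2^e _ _ (inj₁ (c , refl)) disc =
    ℕ.<⇒≱ (2^<n c (^-reflects-< 2 k<2^e)) (discriminates⇒≤ (2 ^ c) {{ℕ.m^n≢0 2 c}} disc)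
  excluded k _ k<5^f k+3≤2n (inj₂ (inj₁ (c , refl))) =
    5^-¬discriminates c (ℕ.≰⇒> λ 5n≤4*5^c → ℕ.<⇒≱ (^-reflects-< 5 k<5^f) (f-least c 5n≤4*5^c)) k+3≤2n
  excluded k _ _ k+3≤2n (inj₂ (inj₂ ex)) = ex k+3≤2n

  least : ∀ k → 1 ≤ k → k < 2 ^ e ⊓ 5 ^ f → ¬ Discriminates n k
  least k 1≤k k<min = excluded k k<2^e (ℕ.<-≤-trans k<min (ℕ.m⊓n≤n _ _)) (below-2^ k e 2^<n 1≤k k<2^e)
    (powers-or-excluded k {{ℕ.>-nonZero 1≤k}})
    where
    k<2^e = ℕ.<-≤-trans k<min (ℕ.m⊓n≤m _ _)
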